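{- Let $0\le\delta<1$, $\beta\in(0,1-\delta)$, and $w_1,\dots,w_\ell\in\mathbb{R}^n$ with $\ell=\delta n$. Consider the semidefinite program: minimize $\sum_{i=1}^n q_i$ over $\eta\in\mathbb{R}^\ell$, $q\in\mathbb{R}^n$ with $q\ge0$, and $n\times n$ positive semidefinite $G$, subject to \[ \sum_{k=1}^\ell\eta_k w_kw_k^T+G-\frac1\beta\mathrm{diag}(G)+\sum_{i=1}^n q_ie_ie_i^T\succeq I. \] Then every feasible solution has objective value at least $(1-\delta-\beta)n$; in particular its optimum value is at least $(1-\delta-\beta)n$.
   Context: $e_i$ is the $i$-th standard basis vector, $I$ the identity, $\mathrm{diag}(G)$ the diagonal part of $G$, and $\succeq$ the positive semidefinite order. -}

module Defs where

open import Algebra.Bundles using (CommutativeRing)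
open import Algebra.Structures using (IsCommutativeRing)
import Algebra.Properties.Monoid.Sum as MonoidSum
open import Data.Fin.Base using (Fin)
import Data.Fin.Properties as Fin
open import Data.Integer.Base as ℤ using (+_)
open import Data.Nat.Base as ℕ using (ℕ)
import Data.Nat.Properties as ℕ
open import Data.Product.Base using (∃; ∃-syntax; _×_; _,_; proj₁; proj₂)
open import Data.Rational.Base as ℚ using (ℚ; 0ℚ; 1ℚ; ½)
import Data.Rational.Properties as ℚ
open import Data.Rational.Solver using (module +-*-Solver)
open import Data.Vec.Functional using (Vector)
open import Level using (0ℓ)
open import Relation.Binary.Structures using (IsEquivalence)
open import Relation.Binary.PropositionalEquality
open import Relation.Nullary.Decidable.Core using (yes; no)

private
  half-pos : ∀ {ε} → 0ℚ ℚ.< ε → 0ℚ ℚ.< ½ ℚ.* ε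
  half-pos {ε} ε>0 = subst (ℚ._< ½ ℚ.* ε) (ℚ.*-zeroʳ ½) (ℚ.*-monoʳ-<-pos ½ ε>0)

  half+half : ∀ ε → ½ ℚ.* ε ℚ.+ ½ ℚ.* ε ≡ ε
  half+half = solve 1 (λ e → con ½ :* e :+ con ½ :* e := e) refl
    where open +-*-Solver

  pos*pos : ∀ {p q} → 0ℚ ℚ.< p → 0ℚ ℚ.< q → 0ℚ ℚ.< p ℚ.* q
  pos*pos {p} {q} p>0 q>0 =
    subst (ℚ._< p ℚ.* q) (ℚ.*-zeroʳ p) (ℚ.*-monoʳ-<-pos p {{ℚ.positive p>0}} q>0)

  ∣-∣-sum : ∀ {p q ε δ} → ℚ.∣ p ∣ ℚ.≤ ε → ℚ.∣ q ∣ ℚ.≤ δ → ℚ.∣ p ℚ.+ q ∣ ℚ.≤ ε ℚ.+ δ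
  ∣-∣-sum {p} {q} p≤ q≤ = ℚ.≤-trans (ℚ.∣p+q∣≤∣p∣+∣q∣ p q) (ℚ.+-mono-≤ p≤ q≤)

  ∣-∣-half-sum : ∀ {p q ε} → ℚ.∣ p ∣ ℚ.≤ ½ ℚ.* ε → ℚ.∣ q ∣ ℚ.≤ ½ ℚ.* ε →
                 ℚ.∣ p ℚ.+ q ∣ ℚ.≤ ε
  ∣-∣-half-sum {p} {q} {ε} p≤ q≤ =
    subst (ℚ.∣ p ℚ.+ q ∣ ℚ.≤_) (half+half ε) (∣-∣-sum p≤ q≤)

  ∣-∣-prod : ∀ {p q B C} → ℚ.∣ p ∣ ℚ.≤ B → ℚ.∣ q ∣ ℚ.≤ C → ℚ.∣ p ℚ.* q ∣ ℚ.≤ B ℚ.* C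
  ∣-∣-prod {p} {q} {B} {C} p≤ q≤ = begin
    ℚ.∣ p ℚ.* q ∣          ≡⟨ ℚ.∣p*q∣≡∣p∣*∣q∣ p q ⟩
    ℚ.∣ p ∣ ℚ.* ℚ.∣ q ∣    ≤⟨ ℚ.*-monoʳ-≤-nonNeg ℚ.∣ q ∣ {{ℚ.∣-∣-nonNeg q}} p≤ ⟩
    B ℚ.* ℚ.∣ q ∣          ≤⟨ ℚ.*-monoˡ-≤-nonNeg B {{ℚ.nonNegative B≥0}} q≤ ⟩
    B ℚ.* C                ∎
    where
    open ℚ.≤-Reasoning
    B≥0 = ℚ.≤-trans (ℚ.0≤∣p∣ p) p≤

  -- Given B > 0 and ε > 0, a tolerance δ > 0 with B δ = ε.
  shrink : ∀ {B ε} → 0ℚ ℚ.< B → 0ℚ ℚ.< ε → ∃[ δ ] (0ℚ ℚ.< δ × B ℚ.* δ ≡ ε)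
  shrink {B} {ε} B>0 ε>0 = 1/B ℚ.* ε , pos*pos 1/B>0 ε>0 , eq
    where
    instance
      _ = ℚ.positive B>0
      _ = ℚ.pos⇒nonZero B
    1/B = ℚ.1/ B
    1/B>0 : 0ℚ ℚ.< 1/B
    1/B>0 = ℚ.positive⁻¹ 1/B {{ℚ.1/pos⇒pos B}}
    eq : B ℚ.* (1/B ℚ.* ε) ≡ ε
    eq = trans (sym (ℚ.*-assoc B 1/B ε))
               (trans (cong (ℚ._* ε) (ℚ.*-inverseʳ B)) (ℚ.*-identityˡ ε))

  ∣p-p∣≤ε : ∀ p {ε} → 0ℚ ℚ.< ε → ℚ.∣ p ℚ.- p ∣ ℚ.≤ ε
  ∣p-p∣≤ε p {ε} ε>0 = subst (λ z → ℚ.∣ z ∣ ℚ.≤ ε) (sym (ℚ.+-inverseʳ p)) (ℚ.<⇒≤ ε>0)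

  ∣-∣-flip : ∀ p q {ε} → ℚ.∣ p ℚ.- q ∣ ℚ.≤ ε → ℚ.∣ q ℚ.- p ∣ ℚ.≤ ε
  ∣-∣-flip p q {ε} = subst (ℚ._≤ ε) (trans (sym (ℚ.∣-p∣≡∣p∣ (p ℚ.- q))) (cong ℚ.∣_∣ (eq p q)))
    where
    open +-*-Solver
    eq : ∀ p q → ℚ.- (p ℚ.- q) ≡ q ℚ.- p
    eq = solve 2 (λ p q → :- (p :- q) := q :- p) refl

  ∣-∣-trans : ∀ p q r {ε} → ℚ.∣ p ℚ.- q ∣ ℚ.≤ ½ ℚ.* ε → ℚ.∣ q ℚ.- r ∣ ℚ.≤ ½ ℚ.* ε →
              ℚ.∣ p ℚ.- r ∣ ℚ.≤ ε
  ∣-∣-trans p q r {ε} a b = subst (λ z → ℚ.∣ z ∣ ℚ.≤ ε) (eq p q r) (∣-∣-half-sum a b)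
    where
    open +-*-Solver
    eq : ∀ p q r → (p ℚ.- q) ℚ.+ (q ℚ.- r) ≡ p ℚ.- r
    eq = solve 3 (λ p q r → (p :- q) :+ (q :- r) := p :- r) refl

  ∣-∣-+ : ∀ a b c d {ε} → ℚ.∣ a ℚ.- c ∣ ℚ.≤ ½ ℚ.* ε → ℚ.∣ b ℚ.- d ∣ ℚ.≤ ½ ℚ.* ε →
          ℚ.∣ (a ℚ.+ b) ℚ.- (c ℚ.+ d) ∣ ℚ.≤ ε
  ∣-∣-+ a b c d {ε} p q = subst (λ z → ℚ.∣ z ∣ ℚ.≤ ε) (eq a b c d) (∣-∣-half-sum p q)
    where
    open +-*-Solver
    eq : ∀ a b c d → (a ℚ.- c) ℚ.+ (b ℚ.- d) ≡ (a ℚ.+ b) ℚ.- (c ℚ.+ d)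
    eq = solve 4 (λ a b c d → (a :- c) :+ (b :- d) := (a :+ b) :- (c :+ d)) refl

  ∣-∣-neg : ∀ a c {ε} → ℚ.∣ a ℚ.- c ∣ ℚ.≤ ε → ℚ.∣ (ℚ.- a) ℚ.- (ℚ.- c) ∣ ℚ.≤ ε
  ∣-∣-neg a c {ε} p =
    subst (λ z → ℚ.∣ z ∣ ℚ.≤ ε) (eq a c) (∣-∣-flip a c p)
    where
    open +-*-Solver
    eq : ∀ a c → c ℚ.- a ≡ (ℚ.- a) ℚ.- (ℚ.- c)
    eq = solve 2 (λ a c → c :- a := (:- a) :- (:- c)) refl

  ∣-∣-* : ∀ a b c d {B C δ δ′ ε} → ℚ.∣ a ∣ ℚ.≤ B → ℚ.∣ d ∣ ℚ.≤ C →
          ℚ.∣ b ℚ.- d ∣ ℚ.≤ δ → ℚ.∣ a ℚ.- c ∣ ℚ.≤ δ′ →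
          B ℚ.* δ ≡ ½ ℚ.* ε → C ℚ.* δ′ ≡ ½ ℚ.* ε →
          ℚ.∣ (a ℚ.* b) ℚ.- (c ℚ.* d) ∣ ℚ.≤ ε
  ∣-∣-* a b c d {ε = ε} a≤ d≤ b-d≤ a-c≤ eq₁ eq₂ =
    subst (λ z → ℚ.∣ z ∣ ℚ.≤ ε) (eq a b c d)
      (∣-∣-half-sum {a ℚ.* (b ℚ.- d)} {d ℚ.* (a ℚ.- c)}
        (subst (ℚ.∣ a ℚ.* (b ℚ.- d) ∣ ℚ.≤_) eq₁ (∣-∣-prod a≤ b-d≤))
        (subst (ℚ.∣ d ℚ.* (a ℚ.- c) ∣ ℚ.≤_) eq₂ (∣-∣-prod d≤ a-c≤)))
    where
    open +-*-Solver
    eq : ∀ a b c d → a ℚ.* (b ℚ.- d) ℚ.+ d ℚ.* (a ℚ.- c) ≡ (a ℚ.* b) ℚ.- (c ℚ.* d)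
    eq = solve 4 (λ a b c d → a :* (b :- d) :+ d :* (a :- c) := (a :* b) :- (c :* d)) refl

-- Real numbers are Cauchy sequences of rationals, up to the setoid equality _≈_.
Eventually : (ℕ → Set) → Set
Eventually P = ∃[ N ] (∀ n → N ℕ.≤ n → P n)

Cauchy : (ℕ → ℚ) → Set
Cauchy x = ∀ ε → 0ℚ ℚ.< ε →
  ∃[ N ] (∀ m n → N ℕ.≤ m → N ℕ.≤ n → ℚ.∣ x m ℚ.- x n ∣ ℚ.≤ ε)

record ℝ : Set where
  no-eta-equality
  constructor mkℝ
  field
    seq    : ℕ → ℚ
    cauchy : Cauchy seq

open ℝ public

infix 4 _≈_ _<_ _≤_

record _≈_ (x y : ℝ) : Set where
  constructor mk≈
  field
    ≈-at : ∀ ε → 0ℚ ℚ.< ε → Eventually λ n → ℚ.∣ seq x n ℚ.- seq y n ∣ ℚ.≤ ε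

record _<_ (x y : ℝ) : Set where
  constructor mk<
  field
    gap   : ℚ
    gap>0 : 0ℚ ℚ.< gap
    <-gap : Eventually λ n → seq x n ℚ.+ gap ℚ.≤ seq y n

record _≤_ (x y : ℝ) : Set where
  constructor mk≤
  field
    ≤-at : ∀ ε → 0ℚ ℚ.< ε → Eventually λ n → seq x n ℚ.≤ seq y n ℚ.+ ε

open _≈_ public
open _<_ public
open _≤_ public

private
  zip : ∀ {P Q R : ℕ → Set} → (∀ n → P n → Q n → R n) →
        Eventually P → Eventually Q → Eventually R
  zip f (M , p) (N , q) = M ℕ.⊔ N , λ n le →
    f n (p n (ℕ.≤-trans (ℕ.m≤m⊔n M N) le)) (q n (ℕ.≤-trans (ℕ.m≤n⊔m M N) le))

  bound : ∀ x → ∃[ B ] (0ℚ ℚ.< B × Eventually λ n → ℚ.∣ seq x n ∣ ℚ.≤ B)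
  bound x with cauchy x 1ℚ (ℚ.positive⁻¹ 1ℚ)
  ... | N , c = 1ℚ ℚ.+ ℚ.∣ a ∣ , B>0 , N , λ n le →
    subst (λ z → ℚ.∣ z ∣ ℚ.≤ 1ℚ ℚ.+ ℚ.∣ a ∣) (eq (seq x n) a)
      (∣-∣-sum {seq x n ℚ.- a} {a} (c n N le ℕ.≤-refl) ℚ.≤-refl)
    where
    a = seq x N
    B>0 : 0ℚ ℚ.< 1ℚ ℚ.+ ℚ.∣ a ∣
    B>0 = ℚ.+-mono-<-≤ (ℚ.positive⁻¹ 1ℚ) (ℚ.0≤∣p∣ a)
    open +-*-Solver
    eq : ∀ p q → (p ℚ.- q) ℚ.+ q ≡ p
    eq = solve 2 (λ p q → (p :- q) :+ q := p) refl

  const-cauchy : ∀ p → Cauchy (λ _ → p)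
  const-cauchy p ε ε>0 = 0 , λ _ _ _ _ → ∣p-p∣≤ε p ε>0

  +-cauchy : ∀ x y → Cauchy (λ n → seq x n ℚ.+ seq y n)
  +-cauchy x y ε ε>0 with cauchy x _ (half-pos ε>0) | cauchy y _ (half-pos ε>0)
  ... | M , p | N , q = M ℕ.⊔ N , λ m n lm ln →
    ∣-∣-+ (seq x m) (seq y m) (seq x n) (seq y n)
      (p m n (ℕ.≤-trans (ℕ.m≤m⊔n M N) lm) (ℕ.≤-trans (ℕ.m≤m⊔n M N) ln))
      (q m n (ℕ.≤-trans (ℕ.m≤n⊔m M N) lm) (ℕ.≤-trans (ℕ.m≤n⊔m M N) ln))

  neg-cauchy : ∀ x → Cauchy (λ n → ℚ.- seq x n)
  neg-cauchy x ε ε>0 with cauchy x ε ε>0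
  ... | N , p = N , λ m n lm ln → ∣-∣-neg (seq x m) (seq x n) (p m n lm ln)

  *-cauchy : ∀ x y → Cauchy (λ n → seq x n ℚ.* seq y n)
  *-cauchy x y ε ε>0 =
    let B , B>0 , K , b = bound x
        C , C>0 , L , c = bound y
        δ  , δ>0  , eq  = shrink {B} {½ ℚ.* ε} B>0 (half-pos ε>0)
        δ′ , δ′>0 , eq′ = shrink {C} {½ ℚ.* ε} C>0 (half-pos ε>0)
        M , q = cauchy y δ δ>0
        N , p = cauchy x δ′ δ′>0
        left  = λ {k} → ℕ.≤-trans {k = k} (ℕ.m≤m⊔n (K ℕ.⊔ L) (M ℕ.⊔ N))
        right = λ {k} → ℕ.≤-trans {k = k} (ℕ.m≤n⊔m (K ℕ.⊔ L) (M ℕ.⊔ N))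
    in (K ℕ.⊔ L) ℕ.⊔ (M ℕ.⊔ N) , λ m n lm ln →
    ∣-∣-* (seq x m) (seq y m) (seq x n) (seq y n) {B} {C} {δ} {δ′} {ε}
      (b m (ℕ.≤-trans (ℕ.m≤m⊔n K L) (left lm)))
      (c n (ℕ.≤-trans (ℕ.m≤n⊔m K L) (left ln)))
      (q m n (ℕ.≤-trans (ℕ.m≤m⊔n M N) (right lm)) (ℕ.≤-trans (ℕ.m≤m⊔n M N) (right ln)))
      (p m n (ℕ.≤-trans (ℕ.m≤n⊔m M N) (right lm)) (ℕ.≤-trans (ℕ.m≤n⊔m M N) (right ln)))
      eq eq′

infix  8 -_
infixl 7 _*_
infixl 6 _+_ _-_

fromℚ : ℚ → ℝ
fromℚ p = mkℝ (λ _ → p) (const-cauchy p)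

fromℕ : ℕ → ℝ
fromℕ n = fromℚ (+ n ℚ./ 1)

0ℝ 1ℝ : ℝ
0ℝ = fromℚ 0ℚ
1ℝ = fromℚ 1ℚ

-- Opaque because the normal forms of rational operations are very large.
opaque
  _+_ _*_ : ℝ → ℝ → ℝ
  x + y = mkℝ (λ n → seq x n ℚ.+ seq y n) (+-cauchy x y)
  x * y = mkℝ (λ n → seq x n ℚ.* seq y n) (*-cauchy x y)

  -_ : ℝ → ℝ
  - x = mkℝ (λ n → ℚ.- seq x n) (neg-cauchy x)

_-_ : ℝ → ℝ → ℝ
x - y = x + (- y)

≈-isEquivalence : IsEquivalence _≈_
≈-isEquivalence = record
  { refl  = λ {x} → mk≈ λ ε ε>0 → 0 , λ n _ → ∣p-p∣≤ε (seq x n) ε>0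
  ; sym   = λ {x} {y} p → mk≈ λ ε ε>0 →
      proj₁ (≈-at p ε ε>0) , λ n le → ∣-∣-flip (seq x n) (seq y n) (proj₂ (≈-at p ε ε>0) n le)
  ; trans = λ {x} {y} {z} p q → mk≈ λ ε ε>0 →
      zip (λ n → ∣-∣-trans (seq x n) (seq y n) (seq z n) {ε})
        (≈-at p (½ ℚ.* ε) (half-pos ε>0)) (≈-at q (½ ℚ.* ε) (half-pos ε>0))
  }

private
  pointwise : ∀ {x y} → (∀ n → seq x n ≡ seq y n) → x ≈ y
  pointwise {x} eq = mk≈ λ ε ε>0 → 0 , λ n _ →
    subst (λ z → ℚ.∣ seq x n ℚ.- z ∣ ℚ.≤ ε) (eq n) (∣p-p∣≤ε (seq x n) ε>0)

opaque
  unfolding _+_ _*_ -_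

  +-cong : ∀ {x y u v} → x ≈ y → u ≈ v → x + u ≈ y + v
  +-cong {x} {y} {u} {v} p q = mk≈ λ ε ε>0 →
    zip (λ n → ∣-∣-+ (seq x n) (seq u n) (seq y n) (seq v n) {ε})
      (≈-at p (½ ℚ.* ε) (half-pos ε>0)) (≈-at q (½ ℚ.* ε) (half-pos ε>0))

  -‿cong : ∀ {x y} → x ≈ y → - x ≈ - y
  -‿cong {x} {y} p = mk≈ λ ε ε>0 →
    proj₁ (≈-at p ε ε>0) , λ n le → ∣-∣-neg (seq x n) (seq y n) (proj₂ (≈-at p ε ε>0) n le)

  *-cong : ∀ {x y u v} → x ≈ y → u ≈ v → x * u ≈ y * v
  *-cong {x} {y} {u} {v} p q = mk≈ λ ε ε>0 →
    let B , B>0 , b = bound x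
        C , C>0 , c = bound v
        δ  , δ>0  , eq  = shrink {B} {½ ℚ.* ε} B>0 (half-pos ε>0)
        δ′ , δ′>0 , eq′ = shrink {C} {½ ℚ.* ε} C>0 (half-pos ε>0)
    in
    zip (λ n (b , c) (s , t) →
          ∣-∣-* (seq x n) (seq u n) (seq y n) (seq v n) {B} {C} {δ} {δ′} {ε} b c s t eq eq′)
      (zip (λ _ → _,_) b c) (zip (λ _ → _,_) (≈-at q δ δ>0) (≈-at p δ′ δ′>0))

  +-*-isCommutativeRing : IsCommutativeRing _≈_ _+_ _*_ -_ 0ℝ 1ℝ
  +-*-isCommutativeRing = record
    { isRing = record
      { +-isAbelianGroup = record
        { isGroup = record
          { isMonoid = record
            { isSemigroup = record
              { isMagma = record { isEquivalence = ≈-isEquivalence ; ∙-cong = +-cong }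
              ; assoc   = λ x y z → pointwise λ n → ℚ.+-assoc (seq x n) (seq y n) (seq z n)
              }
            ; identity = (λ x → pointwise λ n → ℚ.+-identityˡ (seq x n))
                       , (λ x → pointwise λ n → ℚ.+-identityʳ (seq x n))
            }
          ; inverse = (λ x → pointwise λ n → ℚ.+-inverseˡ (seq x n))
                    , (λ x → pointwise λ n → ℚ.+-inverseʳ (seq x n))
          ; ⁻¹-cong = -‿cong
          }
        ; comm = λ x y → pointwise λ n → ℚ.+-comm (seq x n) (seq y n)
        }
      ; *-cong     = *-cong
      ; *-assoc    = λ x y z → pointwise λ n → ℚ.*-assoc (seq x n) (seq y n) (seq z n)
      ; *-identity = (λ x → pointwise λ n → ℚ.*-identityˡ (seq x n))
                   , (λ x → pointwise λ n → ℚ.*-identityʳ (seq x n))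
      ; distrib    = (λ x y z → pointwise λ n → ℚ.*-distribˡ-+ (seq x n) (seq y n) (seq z n))
                   , (λ x y z → pointwise λ n → ℚ.*-distribʳ-+ (seq x n) (seq y n) (seq z n))
      }
    ; *-comm = λ x y → pointwise λ n → ℚ.*-comm (seq x n) (seq y n)
    }

+-*-commutativeRing : CommutativeRing 0ℓ 0ℓ
+-*-commutativeRing = record { isCommutativeRing = +-*-isCommutativeRing }

open MonoidSum (CommutativeRing.+-monoid +-*-commutativeRing) public
  using (sum; sum-syntax)

-- If x is eventually at least ε > 0, then the terms ε ⊔ xₙ eventually
-- agree with xₙ and can always be inverted.
module _ (x : ℝ) (x>0 : 0ℝ < x) where
  private
    ε : ℚ
    ε = gap x>0

    ε>0 : 0ℚ ℚ.< ε
    ε>0 = gap>0 x>0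

    N₀ : ℕ
    N₀ = proj₁ (<-gap x>0)

    x≥ε : ∀ n → N₀ ℕ.≤ n → ε ℚ.≤ seq x n
    x≥ε n le = subst (ℚ._≤ seq x n) (ℚ.+-identityˡ ε) (proj₂ (<-gap x>0) n le)

    max>0 : ∀ n → 0ℚ ℚ.< ε ℚ.⊔ seq x n
    max>0 n = ℚ.<-≤-trans ε>0 (ℚ.p≤p⊔q ε (seq x n))

    max≡ : ∀ n → N₀ ℕ.≤ n → ε ℚ.⊔ seq x n ≡ seq x n
    max≡ n le = ℚ.p≤q⇒p⊔q≡q (x≥ε n le)

    r : ℕ → ℚ
    r n = ℚ.1/_ (ε ℚ.⊔ seq x n) {{ℚ.pos⇒nonZero (ε ℚ.⊔ seq x n) {{ℚ.positive (max>0 n)}}}}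

    r-inv : ∀ n → (ε ℚ.⊔ seq x n) ℚ.* r n ≡ 1ℚ
    r-inv n = ℚ.*-inverseʳ (ε ℚ.⊔ seq x n) {{ℚ.pos⇒nonZero (ε ℚ.⊔ seq x n) {{ℚ.positive (max>0 n)}}}}

    inv : ∀ n → N₀ ℕ.≤ n → seq x n ℚ.* r n ≡ 1ℚ
    inv n le = trans (cong (ℚ._* r n) (sym (max≡ n le))) (r-inv n)

    r>0 : ∀ n → 0ℚ ℚ.< r n
    r>0 n = ℚ.positive⁻¹ (r n)
      {{ℚ.1/pos⇒pos (ε ℚ.⊔ seq x n) {{ℚ.positive (max>0 n)}}}}

    ε*r≤1 : ∀ n → ε ℚ.* r n ℚ.≤ 1ℚ
    ε*r≤1 n = subst (ε ℚ.* r n ℚ.≤_) (r-inv n)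
      (ℚ.*-monoʳ-≤-nonNeg (r n) {{ℚ.nonNegative (ℚ.<⇒≤ (r>0 n))}} (ℚ.p≤p⊔q ε (seq x n)))

    -- With a r = 1 and b s = 1 one has ε² (r - s) = (ε r) (ε s) (b - a).
    diff : ∀ a b r s → a ℚ.* r ≡ 1ℚ → b ℚ.* s ≡ 1ℚ →
           (ε ℚ.* r) ℚ.* (ε ℚ.* s) ℚ.* (b ℚ.- a) ≡ (ε ℚ.* ε) ℚ.* (r ℚ.- s)
    diff a b r s p q = begin
      (ε ℚ.* r) ℚ.* (ε ℚ.* s) ℚ.* (b ℚ.- a)
        ≡⟨ solve 5 (λ e a b r s → (e :* r) :* (e :* s) :* (b :- a) :=
                                  (e :* e) :* (r :* (b :* s) :- s :* (a :* r)))
             refl ε a b r s ⟩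
      (ε ℚ.* ε) ℚ.* (r ℚ.* (b ℚ.* s) ℚ.- s ℚ.* (a ℚ.* r))
        ≡⟨ cong₂ (λ u v → (ε ℚ.* ε) ℚ.* (r ℚ.* u ℚ.- s ℚ.* v)) q p ⟩
      (ε ℚ.* ε) ℚ.* (r ℚ.* 1ℚ ℚ.- s ℚ.* 1ℚ)
        ≡⟨ cong₂ (λ u v → (ε ℚ.* ε) ℚ.* (u ℚ.- v)) (ℚ.*-identityʳ r) (ℚ.*-identityʳ s) ⟩
      (ε ℚ.* ε) ℚ.* (r ℚ.- s) ∎
      where
      open ≡-Reasoning
      open +-*-Solver

    ∣εr∣≤1 : ∀ n → ℚ.∣ ε ℚ.* r n ∣ ℚ.≤ 1ℚ
    ∣εr∣≤1 n = subst (ℚ._≤ 1ℚ) (sym (ℚ.0≤p⇒∣p∣≡p (ℚ.<⇒≤ (pos*pos ε>0 (r>0 n))))) (ε*r≤1 n)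

    r-cauchy : Cauchy r
    r-cauchy η η>0 with cauchy x ((ε ℚ.* ε) ℚ.* η) (pos*pos (pos*pos ε>0 ε>0) η>0)
    ... | N , c = N₀ ℕ.⊔ N , λ m n lm ln →
      ℚ.*-cancelˡ-≤-pos (ε ℚ.* ε) {{ε²-pos}} (begin
        (ε ℚ.* ε) ℚ.* ℚ.∣ r m ℚ.- r n ∣
          ≡⟨ cong (ℚ._* ℚ.∣ r m ℚ.- r n ∣) (ℚ.0≤p⇒∣p∣≡p (ℚ.<⇒≤ ε²>0)) ⟨
        ℚ.∣ ε ℚ.* ε ∣ ℚ.* ℚ.∣ r m ℚ.- r n ∣
          ≡⟨ ℚ.∣p*q∣≡∣p∣*∣q∣ (ε ℚ.* ε) (r m ℚ.- r n) ⟨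
        ℚ.∣ (ε ℚ.* ε) ℚ.* (r m ℚ.- r n) ∣
          ≡⟨ cong ℚ.∣_∣ (diff (seq x m) (seq x n) (r m) (r n) (inv m (l lm)) (inv n (l ln))) ⟨
        ℚ.∣ (ε ℚ.* r m) ℚ.* (ε ℚ.* r n) ℚ.* (seq x n ℚ.- seq x m) ∣
          ≤⟨ ∣-∣-prod (∣-∣-prod (∣εr∣≤1 m) (∣εr∣≤1 n)) (c n m (k ln) (k lm)) ⟩
        (1ℚ ℚ.* 1ℚ) ℚ.* ((ε ℚ.* ε) ℚ.* η)
          ≡⟨ ℚ.*-identityˡ _ ⟩
        (ε ℚ.* ε) ℚ.* η ∎)
      where
      open ℚ.≤-Reasoning
      ε²>0 = pos*pos ε>0 ε>0
      ε²-pos = ℚ.positive ε²>0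
      l : ∀ {i} → N₀ ℕ.⊔ N ℕ.≤ i → N₀ ℕ.≤ i
      l = ℕ.≤-trans (ℕ.m≤m⊔n _ N)
      k : ∀ {i} → N₀ ℕ.⊔ N ℕ.≤ i → N ℕ.≤ i
      k = ℕ.≤-trans (ℕ.m≤n⊔m (N₀) N)

  opaque
    unfolding _*_

    recip : ℝ
    recip = mkℝ r r-cauchy

    *-recip : x * recip ≈ 1ℝ
    *-recip = mk≈ λ η η>0 → N₀ , λ n le → close n (inv n le) η>0
      where
      close : ∀ n {η} → seq x n ℚ.* r n ≡ 1ℚ → 0ℚ ℚ.< η → ℚ.∣ seq x n ℚ.* r n ℚ.- 1ℚ ∣ ℚ.≤ η
      close n eq η>0 rewrite eq = ∣p-p∣≤ε 1ℚ η>0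

Matrix : ℕ → Set
Matrix n = Vector (Vector ℝ n) n

infixl 6 _⊕_ _⊖_
infixr 7 _·_

_⊕_ _⊖_ : ∀ {n} → Matrix n → Matrix n → Matrix n
(A ⊕ B) i j = A i j + B i j
(A ⊖ B) i j = A i j - B i j

_·_ : ∀ {n} → ℝ → Matrix n → Matrix n
(c · A) i j = c * A i j

∑ᴹ : ∀ {m n} → Vector (Matrix n) m → Matrix n
∑ᴹ {m} A i j = ∑[ k < m ] A k i j

outer : ∀ {n} → Vector ℝ n → Matrix n
outer v i j = v i * v j

diag : ∀ {n} → Matrix n → Matrix n
diag A i j with i Fin.≟ j
... | yes _ = A i j
... | no  _ = 0ℝ

I : ∀ {n} → Matrix n
I i j with i Fin.≟ j
... | yes _ = 1ℝ
... | no  _ = 0ℝ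

e : ∀ {n} → Fin n → Vector ℝ n
e = I

record PSD {n} (A : Matrix n) : Set where
  field
    symmetric   : ∀ i j → A i j ≈ A j i
    nonnegative : ∀ (x : Vector ℝ n) → 0ℝ ≤ ∑[ i < n ] ∑[ j < n ] (x i * A i j * x j)

infix 4 _⪰_

_⪰_ : ∀ {n} → Matrix n → Matrix n → Set
A ⪰ B = PSD (A ⊖ B)

module SDP {n ℓ : ℕ} (β : ℝ) (β>0 : 0ℝ < β) (w : Vector (Vector ℝ n) ℓ) where

  record Feasible (η : Vector ℝ ℓ) (q : Vector ℝ n) (G : Matrix n) : Set where
    field
      q≥0        : ∀ i → 0ℝ ≤ q i
      G-psd      : PSD G
      constraint : ∑ᴹ (λ k → η k · outer (w k))
                     ⊕ G ⊖ recip β β>0 · diag G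
                     ⊕ ∑ᴹ (λ i → q i · outer (e i))
                   ⪰ I

  objective : Vector ℝ n → ℝ
  objective q = ∑[ i < n ] q i

  IsObjectiveValue : ℝ → Set
  IsObjectiveValue v = ∃[ η ] ∃[ q ] ∃[ G ] (Feasible η q G × v ≈ objective q)

-- Greatest lower bound: the optimum value of a minimisation problem,
-- whether or not it is attained.
IsInfimum : (ℝ → Set) → ℝ → Set
IsInfimum S v = (∀ s → S s → v ≤ s) × (∀ b → (∀ s → S s → b ≤ s) → b ≤ v)

{-# OPTIONS --safe #-}

module Submission where

open import Algebra.Bundles using (CommutativeRing)
import Algebra.Properties.Semiring.Sum as SemiringSum
import Algebra.Solver.Ring as RingSolver
open import Algebra.Solver.Ring.AlmostCommutativeRing using (fromCommutativeRing; _-Raw-AlmostCommutative⟶_)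
open import Data.Empty using (⊥)
open import Data.Fin.Base using (Fin; zero; suc; punchIn; punchOut; _↑ˡ_; _↑ʳ_)
import Data.Fin.Properties as Fin
open import Data.Integer.Base as ℤ using (+_)
import Data.Integer.Properties as ℤ
open import Data.Maybe.Base using (Maybe; just; nothing)
open import Data.Nat.Base as ℕ using (ℕ; zero; suc)
import Data.Nat.Properties as ℕ
open import Data.Product.Base using (∃; ∃-syntax; _×_; _,_; proj₁; proj₂)
open import Data.Rational.Base as ℚ using (ℚ; 0ℚ; 1ℚ; ½)
import Data.Rational.Properties as ℚ
open import Data.Rational.Solver using (module +-*-Solver)
import Data.Rational.Unnormalised.Base as ℚᵘ
import Data.Rational.Unnormalised.Properties as ℚᵘ
open import Data.Sum.Base using (_⊎_; inj₁; inj₂)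
open import Data.Vec.Functional using (Vector; []; _∷_; _++_; head; tail)
import Data.Vec.Functional.Properties as Vector
open import Effect.Monad using (RawMonad)
open import Level using (0ℓ)
open import Relation.Binary.Bundles using (Preorder)
open import Relation.Binary.PropositionalEquality using (_≡_; _≢_; cong; subst; subst₂)
import Relation.Binary.PropositionalEquality as ≡
import Relation.Binary.Reasoning.Preorder as PreorderReasoning
import Relation.Binary.Reasoning.Setoid as SetoidReasoning
open import Relation.Nullary.Decidable.Core using (yes; no; ¬¬-excluded-middle)
open import Relation.Nullary.Negation using (¬_; contradiction; ¬¬-Monad)
open import Defs

open CommutativeRing +-*-commutativeRing
  using (refl; sym; trans; reflexive; setoid; semiring; zeroˡ; zeroʳ; +-identityˡ; +-identityʳ;
         *-identityˡ; *-identityʳ; *-comm; *-assoc; +-comm; +-congˡ; +-congʳ; *-congˡ; *-congʳ)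
open SemiringSum semiring
  using (sum-cong-≋; sum-replicate-zero; ∑-distrib-+; ∑-comm; *-distribˡ-sum; *-distribʳ-sum)
open RawMonad (¬¬-Monad {0ℓ}) using (pure; _>>=_)

module ≈-Reasoning = SetoidReasoning setoid

-- Put D = diag(G) + β s with s > 0 small and Q = D/β − G.  On a subspace where Q is negative,
-- G exceeds D/β, while the trace of G relative to D is at most n; so such a subspace has
-- dimension p ≤ β n.  If y₁, …, yₚ is a maximal Q-orthogonal family of Q-negative vectors, then
-- Q ≥ 0 on the Q-complement of the yₖ.  Intersecting with the complement of the w's leaves a
-- subspace of dimension at least n − ℓ − p on which the constraint reads diag(q) ≥ 1 − s, and
-- taking the trace of its projection gives Σ q ≥ (1 − s)(n − ℓ − p).  Finally s tends to 0.
--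
-- As ≤ on ℝ is stable under double negation, case distinctions on the sign of a real number
-- and the existence of a maximal family may be used inside ¬¬.

-- Why Q has this form: along a vector u orthogonal to every w, the constraint bounds diag(q) below
-- by I + diag(G)/β - G. Adding a value Q(u,u) ≥ 0 cancels G together with diag(G)/β, so nothing
-- about G survives except the perturbation, and βs is chosen because D/β turns it into exactly s.
-- Without it a diagonal entry of G may vanish and D has no inverse to take a trace with.
--
-- Both reductions cost dimension in the same way: orthogonality to the w's and Q-orthogonality to
-- the y's are homogeneous linear equations, ℓ and p of them. Hence a single tool, a nonzero
-- solution of fewer than n equations, drives every construction. No eigenvectors of Q are used,
-- since over Cauchy reals they are hard to come by; orthogonal families grow one vector at a time
-- instead.
--
-- The y's are orthogonal for Q, whereas the trace argument needs vectors orthogonal for D. The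
-- passage between the two is made inside the span of the y's, in the coordinates given by their
-- coefficients.

private
  half-pos : ∀ {ε} → 0ℚ ℚ.< ε → 0ℚ ℚ.< ½ ℚ.* ε
  half-pos {ε} ε>0 = subst (ℚ._< ½ ℚ.* ε) (ℚ.*-zeroʳ ½) (ℚ.*-monoʳ-<-pos ½ ε>0)

  p-q≤ε⇒p≤q+ε : ∀ p q {ε} → p ℚ.- q ℚ.≤ ε → p ℚ.≤ q ℚ.+ ε
  p-q≤ε⇒p≤q+ε p q {ε} le = subst (ℚ._≤ q ℚ.+ ε) (q+[p-q]≡p q p) (ℚ.+-monoʳ-≤ q le)
    where
    open +-*-Solver
    q+[p-q]≡p : ∀ q p → q ℚ.+ (p ℚ.- q) ≡ p
    q+[p-q]≡p = solve 2 (λ q p → q :+ (p :- q) := p) ≡.refl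

  p≤∣p∣ : ∀ p → p ℚ.≤ ℚ.∣ p ∣
  p≤∣p∣ p with ℚ.≤-total 0ℚ p
  ... | inj₁ p≥0 = ℚ.≤-reflexive (≡.sym (ℚ.0≤p⇒∣p∣≡p p≥0))
  ... | inj₂ p≤0 = ℚ.≤-trans p≤0 (ℚ.0≤∣p∣ p)

  ∣p-q∣≤ε⇒p≤q+ε : ∀ p q {ε} → ℚ.∣ p ℚ.- q ∣ ℚ.≤ ε → p ℚ.≤ q ℚ.+ ε
  ∣p-q∣≤ε⇒p≤q+ε p q le = p-q≤ε⇒p≤q+ε p q (ℚ.≤-trans (p≤∣p∣ (p ℚ.- q)) le)

  p≤q+ε⇒∣p-q∣≤ε : ∀ p q {ε} → p ℚ.≤ q ℚ.+ ε → q ℚ.≤ p ℚ.+ ε → ℚ.∣ p ℚ.- q ∣ ℚ.≤ ε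
  p≤q+ε⇒∣p-q∣≤ε p q {ε} le₁ le₂ with ℚ.∣p∣≡p∨∣p∣≡-p (p ℚ.- q)
  ... | inj₁ eq = subst₂ ℚ._≤_ (≡.sym eq) (cancel q ε) (ℚ.+-monoˡ-≤ (ℚ.- q) le₁)
    where
    open +-*-Solver
    cancel : ∀ q ε → q ℚ.+ ε ℚ.- q ≡ ε
    cancel = solve 2 (λ q ε → q :+ ε :- q := ε) ≡.refl
  ... | inj₂ eq = subst₂ ℚ._≤_ (≡.trans (flip p q) (≡.sym eq)) (cancel p ε) (ℚ.+-monoˡ-≤ (ℚ.- p) le₂)
    where
    open +-*-Solver
    cancel : ∀ p ε → p ℚ.+ ε ℚ.- p ≡ ε
    cancel = solve 2 (λ p ε → p :+ ε :- p := ε) ≡.refl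
    flip : ∀ p q → q ℚ.- p ≡ ℚ.- (p ℚ.- q)
    flip = solve 2 (λ p q → q :- p := :- (p :- q)) ≡.refl

  ½+½ : ∀ q ε → (q ℚ.+ ½ ℚ.* ε) ℚ.+ ½ ℚ.* ε ≡ q ℚ.+ ε
  ½+½ = solve 2 (λ q e → q :+ con ½ :* e :+ con ½ :* e := q :+ e) ≡.refl
    where open +-*-Solver

-- The order on Cauchy reals.

eventually₂ : ∀ {P Q R : ℕ → Set} → (∀ n → P n → Q n → R n) →
              Eventually P → Eventually Q → Eventually R
eventually₂ f (M , p) (N , q) = M ℕ.⊔ N , λ n le →
  f n (p n (ℕ.≤-trans (ℕ.m≤m⊔n M N) le)) (q n (ℕ.≤-trans (ℕ.m≤n⊔m M N) le))

≤-reflexive : ∀ {x y} → x ≈ y → x ≤ y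
≤-reflexive {x} {y} x≈y = mk≤ λ ε ε>0 →
  proj₁ (≈-at x≈y ε ε>0) , λ n le →
    ∣p-q∣≤ε⇒p≤q+ε (seq x n) (seq y n) (proj₂ (≈-at x≈y ε ε>0) n le)

≤-refl : ∀ {x} → x ≤ x
≤-refl = ≤-reflexive refl

≤-trans : ∀ {x y z} → x ≤ y → y ≤ z → x ≤ z
≤-trans {x} {y} {z} x≤y y≤z = mk≤ λ ε ε>0 →
  eventually₂ (λ n le₁ le₂ → subst (seq x n ℚ.≤_) (½+½ (seq z n) ε)
                  (ℚ.≤-trans le₁ (ℚ.+-monoˡ-≤ (½ ℚ.* ε) le₂)))
    (≤-at x≤y _ (half-pos ε>0)) (≤-at y≤z _ (half-pos ε>0))

≤-antisym : ∀ {x y} → x ≤ y → y ≤ x → x ≈ y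
≤-antisym {x} {y} x≤y y≤x = mk≈ λ ε ε>0 →
  eventually₂ (λ n → p≤q+ε⇒∣p-q∣≤ε (seq x n) (seq y n)) (≤-at x≤y ε ε>0) (≤-at y≤x ε ε>0)

<⇒≱ : ∀ {x y} → x < y → ¬ y ≤ x
<⇒≱ {x} {y} (mk< g g>0 x<y) y≤x = proj₂ never (proj₁ never) ℕ.≤-refl
  where
  open +-*-Solver
  -- x + g ≤ y ≤ x + g/2 would give g/2 ≤ 0.
  split : ∀ p g → p ℚ.+ g ≡ ½ ℚ.* g ℚ.+ (p ℚ.+ ½ ℚ.* g)
  split = solve 2 (λ p g → p :+ g := con ½ :* g :+ (p :+ con ½ :* g)) ≡.refl
  absurd : ∀ p q → p ℚ.+ g ℚ.≤ q → q ℚ.≤ p ℚ.+ ½ ℚ.* g → ⊥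
  absurd p q le₁ le₂ = ℚ.<-irrefl ≡.refl (ℚ.<-≤-trans
    (subst₂ ℚ._<_ (ℚ.+-identityˡ _) (≡.sym (split p g))
      (ℚ.+-monoˡ-< (p ℚ.+ ½ ℚ.* g) (half-pos g>0)))
    (ℚ.≤-trans le₁ le₂))
  never : Eventually λ _ → ⊥
  never = eventually₂ (λ n → absurd (seq x n) (seq y n)) x<y (≤-at y≤x _ (half-pos g>0))

<⇒≤ : ∀ {x y} → x < y → x ≤ y
<⇒≤ {x} {y} (mk< g g>0 (N , x<y)) = mk≤ λ ε ε>0 → N , λ n N≤n →
  widen (seq x n) (seq y n) ε>0 (x<y n N≤n)
  where
  widen : ∀ p q {ε} → 0ℚ ℚ.< ε → p ℚ.+ g ℚ.≤ q → p ℚ.≤ q ℚ.+ ε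
  widen p q {ε} ε>0 le = subst₂ ℚ._≤_ (ℚ.+-identityʳ p) ≡.refl
    (ℚ.≤-trans (ℚ.+-monoʳ-≤ p (ℚ.<⇒≤ g>0)) (ℚ.≤-trans le
      (subst (ℚ._≤ q ℚ.+ ε) (ℚ.+-identityʳ q) (ℚ.+-monoʳ-≤ q (ℚ.<⇒≤ ε>0)))))

<-≤-trans : ∀ {x y z} → x < y → y ≤ z → x < z
<-≤-trans {x} {y} {z} (mk< g g>0 x<y) y≤z = mk< (½ ℚ.* g) (half-pos g>0)
  (eventually₂ (λ n → shrink (seq x n) (seq y n) (seq z n)) x<y (≤-at y≤z _ (half-pos g>0)))
  where
  open +-*-Solver
  eqˡ : ∀ p g → p ℚ.+ g ℚ.- ½ ℚ.* g ≡ p ℚ.+ ½ ℚ.* g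
  eqˡ = solve 2 (λ p g → p :+ g :- con ½ :* g := p :+ con ½ :* g) ≡.refl
  eqʳ : ∀ p g → p ℚ.+ ½ ℚ.* g ℚ.- ½ ℚ.* g ≡ p
  eqʳ = solve 2 (λ p g → p :+ con ½ :* g :- con ½ :* g := p) ≡.refl
  shrink : ∀ p q r → p ℚ.+ g ℚ.≤ q → q ℚ.≤ r ℚ.+ ½ ℚ.* g → p ℚ.+ ½ ℚ.* g ℚ.≤ r
  shrink p q r le₁ le₂ =
    subst₂ ℚ._≤_ (eqˡ p g) (eqʳ r g) (ℚ.+-monoˡ-≤ (ℚ.- (½ ℚ.* g)) (ℚ.≤-trans le₁ le₂))

≤-<-trans : ∀ {x y z} → x ≤ y → y < z → x < z
≤-<-trans {x} {y} {z} x≤y (mk< g g>0 y<z) = mk< (½ ℚ.* g) (half-pos g>0)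
  (eventually₂ (λ n → shrink (seq x n) (seq y n) (seq z n)) (≤-at x≤y _ (half-pos g>0)) y<z)
  where
  shrink : ∀ p q r → p ℚ.≤ q ℚ.+ ½ ℚ.* g → q ℚ.+ g ℚ.≤ r → p ℚ.+ ½ ℚ.* g ℚ.≤ r
  shrink p q r le₁ le₂ = ℚ.≤-trans
    (subst (p ℚ.+ ½ ℚ.* g ℚ.≤_) (½+½ q g) (ℚ.+-monoˡ-≤ (½ ℚ.* g) le₁)) le₂

opaque
  unfolding _+_ _*_ -_

  +-mono-≤ : ∀ {x y u v} → x ≤ y → u ≤ v → x + u ≤ y + v
  +-mono-≤ {x} {y} {u} {v} x≤y u≤v = mk≤ λ ε ε>0 →
    eventually₂ (λ n le₁ le₂ → subst (seq x n ℚ.+ seq u n ℚ.≤_) (eq (seq y n) (seq v n) ε)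
                    (ℚ.+-mono-≤ le₁ le₂))
      (≤-at x≤y _ (half-pos ε>0)) (≤-at u≤v _ (half-pos ε>0))
    where
    open +-*-Solver
    eq : ∀ p q ε → (p ℚ.+ ½ ℚ.* ε) ℚ.+ (q ℚ.+ ½ ℚ.* ε) ≡ p ℚ.+ q ℚ.+ ε
    eq = solve 3 (λ p q e → (p :+ con ½ :* e) :+ (q :+ con ½ :* e) := p :+ q :+ e) ≡.refl

  +-mono-<-≤ : ∀ {x y u v} → x < y → u ≤ v → x + u < y + v
  +-mono-<-≤ {x} {y} {u} {v} (mk< g g>0 x<y) u≤v = mk< (½ ℚ.* g) (half-pos g>0)
    (eventually₂ (λ n le₁ le₂ → 
        subst₂ ℚ._≤_ (eqˡ (seq x n) (seq u n) g) (eqʳ (seq y n) (seq v n) g)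
          (ℚ.+-monoˡ-≤ (ℚ.- (½ ℚ.* g)) (ℚ.+-mono-≤ le₁ le₂)))
      x<y (≤-at u≤v _ (half-pos g>0)))
    where
    open +-*-Solver
    eqˡ : ∀ p q g → (p ℚ.+ g) ℚ.+ q ℚ.- ½ ℚ.* g ≡ p ℚ.+ q ℚ.+ ½ ℚ.* g
    eqˡ = solve 3 (λ p q g → (p :+ g) :+ q :- con ½ :* g := p :+ q :+ con ½ :* g) ≡.refl
    eqʳ : ∀ p q g → p ℚ.+ (q ℚ.+ ½ ℚ.* g) ℚ.- ½ ℚ.* g ≡ p ℚ.+ q
    eqʳ = solve 3 (λ p q g → p :+ (q :+ con ½ :* g) :- con ½ :* g := p :+ q) ≡.refl

  -- A Cauchy sequence with a term below -ε/2 past the modulus for ε/2 has a negative limit.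
  ≮0⇒≥0 : ∀ {x} → ¬ (x < 0ℝ) → 0ℝ ≤ x
  ≮0⇒≥0 {x} x≮0 = mk≤ λ ε ε>0 →
    let N , c = cauchy x _ (half-pos ε>0)
    in N , λ n N≤n → above (seq x N) (seq x n) ε (c N n ℕ.≤-refl N≤n)
      (ℚ.≮⇒≥ λ x+½ε<0 → x≮0
        (mk< (ℚ.- (seq x N ℚ.+ ½ ℚ.* ε)) (ℚ.neg-antimono-< x+½ε<0)
          (N , λ m N≤m → below (seq x N) (seq x m) ε (c m N N≤m ℕ.≤-refl))))
    where
    above : ∀ p q ε → ℚ.∣ p ℚ.- q ∣ ℚ.≤ ½ ℚ.* ε → 0ℚ ℚ.≤ p ℚ.+ ½ ℚ.* ε → 0ℚ ℚ.≤ q ℚ.+ ε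
    above p q ε le₁ le₂ = ℚ.≤-trans le₂ (subst (p ℚ.+ ½ ℚ.* ε ℚ.≤_) (½+½ q ε)
      (ℚ.+-monoˡ-≤ (½ ℚ.* ε) (∣p-q∣≤ε⇒p≤q+ε p q le₁)))
    below : ∀ p q ε → ℚ.∣ q ℚ.- p ∣ ℚ.≤ ½ ℚ.* ε →
            q ℚ.+ ℚ.- (p ℚ.+ ½ ℚ.* ε) ℚ.≤ 0ℚ
    below p q ε le = subst (q ℚ.+ ℚ.- (p ℚ.+ ½ ℚ.* ε) ℚ.≤_) (ℚ.+-inverseʳ (p ℚ.+ ½ ℚ.* ε))
      (ℚ.+-monoˡ-≤ (ℚ.- (p ℚ.+ ½ ℚ.* ε)) (∣p-q∣≤ε⇒p≤q+ε q p le))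

  *-pos : ∀ {x y} → 0ℝ < x → 0ℝ < y → 0ℝ < x * y
  *-pos {x} {y} (mk< g g>0 0<x) (mk< h h>0 0<y) = mk< (g ℚ.* h)
    (subst (ℚ._< g ℚ.* h) (ℚ.*-zeroʳ g) (ℚ.*-monoʳ-<-pos g {{ℚ.positive g>0}} h>0))
    (eventually₂ (λ n → product (seq x n) (seq y n)) 0<x 0<y)
    where
    product : ∀ p q → 0ℚ ℚ.+ g ℚ.≤ p → 0ℚ ℚ.+ h ℚ.≤ q → 0ℚ ℚ.+ g ℚ.* h ℚ.≤ p ℚ.* q
    product p q le₁ le₂ rewrite ℚ.+-identityˡ g | ℚ.+-identityˡ h | ℚ.+-identityˡ (g ℚ.* h) =
      ℚ.≤-trans
        (ℚ.*-monoˡ-≤-nonNeg g {{ℚ.nonNegative (ℚ.<⇒≤ g>0)}} le₂)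
        (ℚ.*-monoʳ-≤-nonNeg q {{ℚ.nonNegative (ℚ.≤-trans (ℚ.<⇒≤ h>0) le₂)}} le₁)

  fromℚ-+ : ∀ p q → fromℚ (p ℚ.+ q) ≈ fromℚ p + fromℚ q
  fromℚ-+ p q = mk≈ λ ε ε>0 → 0 , λ _ _ →
    subst (ℚ._≤ ε) (≡.sym (cong ℚ.∣_∣ (ℚ.+-inverseʳ (p ℚ.+ q)))) (ℚ.<⇒≤ ε>0)

  fromℚ-* : ∀ p q → fromℚ (p ℚ.* q) ≈ fromℚ p * fromℚ q
  fromℚ-* p q = mk≈ λ ε ε>0 → 0 , λ _ _ →
    subst (ℚ._≤ ε) (≡.sym (cong ℚ.∣_∣ (ℚ.+-inverseʳ (p ℚ.* q)))) (ℚ.<⇒≤ ε>0)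

  fromℚ-neg : ∀ p → fromℚ (ℚ.- p) ≈ - fromℚ p
  fromℚ-neg p = mk≈ λ ε ε>0 → 0 , λ _ _ →
    subst (ℚ._≤ ε) (≡.sym (cong ℚ.∣_∣ (ℚ.+-inverseʳ (ℚ.- p)))) (ℚ.<⇒≤ ε>0)

-- The solver must compare coefficients, and real equality comes with no decision procedure;
-- rational coefficients have one.
fromℚ-morphism : ℚ.+-*-rawRing -Raw-AlmostCommutative⟶ fromCommutativeRing +-*-commutativeRing
fromℚ-morphism = record
  { ⟦_⟧    = fromℚ
  ; +-homo = fromℚ-+
  ; *-homo = fromℚ-*
  ; -‿homo = fromℚ-neg
  ; 0-homo = refl
  ; 1-homo = refl
  }

fromℚ-≟ : ∀ p q → Maybe (fromℚ p ≈ fromℚ q)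
fromℚ-≟ p q with p ℚ.≟ q
... | yes ≡.refl = just refl
... | no _       = nothing

module ℝ-Solver =
  RingSolver ℚ.+-*-rawRing (fromCommutativeRing +-*-commutativeRing) fromℚ-morphism fromℚ-≟

open ℝ-Solver using (solve; _:+_; _:*_; _:-_; :-_; con; _:=_)

≤-preorder : Preorder 0ℓ 0ℓ 0ℓ
≤-preorder = record
  { isPreorder = record
    { isEquivalence = ≈-isEquivalence ; reflexive = ≤-reflexive ; trans = ≤-trans } }

module ≤-Reasoning = PreorderReasoning ≤-preorder

-- Ordered-ring laws and sign distinctions under double negation.

x≤y⇒0≤y-x : ∀ {x y} → x ≤ y → 0ℝ ≤ y - x
x≤y⇒0≤y-x {x} {y} x≤y = begin
  0ℝ     ≈⟨ solve 1 (λ x → con 0ℚ := x :- x) refl x ⟩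
  x - x  ≲⟨ +-mono-≤ x≤y ≤-refl ⟩
  y - x  ∎
  where open ≤-Reasoning

0≤y-x⇒x≤y : ∀ {x y} → 0ℝ ≤ y - x → x ≤ y
0≤y-x⇒x≤y {x} {y} 0≤y-x = begin
  x            ≈⟨ +-identityˡ x ⟨
  0ℝ + x       ≲⟨ +-mono-≤ 0≤y-x ≤-refl ⟩
  (y - x) + x  ≈⟨ solve 2 (λ x y → (y :- x) :+ x := y) refl x y ⟩
  y            ∎
  where open ≤-Reasoning

<-respˡ-≈ : ∀ {x y z} → x ≈ y → x < z → y < z
<-respˡ-≈ x≈y = ≤-<-trans (≤-reflexive (sym x≈y))

<-respʳ-≈ : ∀ {x y z} → y ≈ z → x < y → x < z
<-respʳ-≈ y≈z x<y = <-≤-trans x<y (≤-reflexive y≈z)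

0≤⇒+ : ∀ {x y} → 0ℝ ≤ x → 0ℝ ≤ y → 0ℝ ≤ x + y
0≤⇒+ 0≤x 0≤y = ≤-trans (≤-reflexive (sym (+-identityˡ 0ℝ))) (+-mono-≤ 0≤x 0≤y)

0<⇒+ˡ : ∀ {x y} → 0ℝ < x → 0ℝ ≤ y → 0ℝ < x + y
0<⇒+ˡ 0<x 0≤y = <-respˡ-≈ (+-identityˡ 0ℝ) (+-mono-<-≤ 0<x 0≤y)

x<y⇒0<y-x : ∀ {x y} → x < y → 0ℝ < y - x
x<y⇒0<y-x {x} x<y =
  <-respˡ-≈ (solve 1 (λ x → x :- x := con 0ℚ) refl x) (+-mono-<-≤ x<y ≤-refl)

≮⇒≥ : ∀ {x y} → ¬ (x < y) → y ≤ x
≮⇒≥ {x} {y} x≮y = 0≤y-x⇒x≤y (≮0⇒≥0 λ x-y<0 → x≮y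
  (<-respˡ-≈ (solve 2 (λ x y → (x :- y) :+ y := x) refl x y)
    (<-respʳ-≈ (+-identityˡ y) (+-mono-<-≤ x-y<0 ≤-refl))))

-- By `≮⇒≥` and `<⇒≱`, `x ≤ y` amounts to the negation of `y < x`, and negations are stable.
≤-stable : ∀ {x y} → ¬ ¬ (x ≤ y) → x ≤ y
≤-stable ¬¬x≤y = ≮⇒≥ λ y<x → ¬¬x≤y (<⇒≱ y<x)

≈-stable : ∀ {x y} → ¬ ¬ (x ≈ y) → x ≈ y
≈-stable ¬¬x≈y = ≤-antisym
  (≤-stable (¬¬x≈y >>= λ x≈y → pure (≤-reflexive x≈y)))
  (≤-stable (¬¬x≈y >>= λ x≈y → pure (≤-reflexive (sym x≈y))))

x<0⇒0<-x : ∀ {x} → x < 0ℝ → 0ℝ < - x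
x<0⇒0<-x {x} x<0 = <-respʳ-≈ (+-identityˡ (- x)) (x<y⇒0<y-x x<0)

data Sign (x : ℝ) : Set where
  neg  : x < 0ℝ → Sign x
  null : x ≈ 0ℝ → Sign x
  pos  : 0ℝ < x → Sign x

-- Refuting all three cases excludes both strict ones, which forces equality by antisymmetry, the
-- remaining case.
sign : ∀ x → ¬ ¬ Sign x
sign x ¬sign = ¬sign (null (≤-antisym
  (≮⇒≥ λ 0<x → ¬sign (pos 0<x)) (≮⇒≥ λ x<0 → ¬sign (neg x<0))))

0<⇒0<² : ∀ {x} → 0ℝ < x → 0ℝ < x * x
0<⇒0<² 0<x = *-pos 0<x 0<x

0-or-0<² : ∀ x → ¬ ¬ (x ≈ 0ℝ ⊎ 0ℝ < x * x)
0-or-0<² x = sign x >>= λ where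
  (neg x<0)  → pure (inj₂ (<-respʳ-≈ (solve 1 (λ x → :- x :* :- x := x :* x) refl x)
                 (0<⇒0<² (x<0⇒0<-x x<0))))
  (null x≈0) → pure (inj₁ x≈0)
  (pos 0<x)  → pure (inj₂ (0<⇒0<² 0<x))

0≤² : ∀ x → 0ℝ ≤ x * x
0≤² x = ≤-stable (0-or-0<² x >>= λ where
  (inj₁ x≈0)  → pure (≤-reflexive (sym (trans (*-congˡ x≈0) (zeroʳ x))))
  (inj₂ 0<x²) → pure (<⇒≤ 0<x²))

-- Only strict positivity carries a gap that can be multiplied, so vanishing factors are split off
-- inside the double negation.
0≤⇒* : ∀ {x y} → 0ℝ ≤ x → 0ℝ ≤ y → 0ℝ ≤ x * y
0≤⇒* {x} {y} 0≤x 0≤y = ≤-stable (sign x >>= λ where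
  (neg x<0)  → contradiction 0≤x (<⇒≱ x<0)
  (null x≈0) → pure (≤-reflexive (sym (trans (*-congʳ x≈0) (zeroˡ y))))
  (pos 0<x)  → sign y >>= λ where
    (neg y<0)  → contradiction 0≤y (<⇒≱ y<0)
    (null y≈0) → pure (≤-reflexive (sym (trans (*-congˡ y≈0) (zeroʳ x))))
    (pos 0<y)  → pure (<⇒≤ (*-pos 0<x 0<y)))

*-monoˡ-≤ : ∀ {a x y} → 0ℝ ≤ a → x ≤ y → a * x ≤ a * y
*-monoˡ-≤ {a} {x} {y} 0≤a x≤y = 0≤y-x⇒x≤y (≤-trans (0≤⇒* 0≤a (x≤y⇒0≤y-x x≤y))
  (≤-reflexive (solve 3 (λ a x y → a :* (y :- x) := a :* y :- a :* x) refl a x y)))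

0<1 : 0ℝ < 1ℝ
0<1 = mk< 1ℚ (ℚ.positive⁻¹ 1ℚ) (0 , λ _ _ → ℚ.≤-refl)

-- A negative `y` would make the product 1 at most 0. This gives the sign of a reciprocal from its
-- defining equation alone.
0≤-inverse : ∀ {x y} → 0ℝ ≤ x → x * y ≈ 1ℝ → 0ℝ ≤ y
0≤-inverse {x} {y} 0≤x xy≈1 = ≮⇒≥ λ y<0 → <⇒≱ 0<1 (begin
  1ℝ               ≈⟨ xy≈1 ⟨
  x * y            ≈⟨ solve 2 (λ x y → x :* y := con 0ℚ :- x :* (:- y)) refl x y ⟩
  0ℝ - x * (- y)   ≲⟨ +-mono-≤ (0≤⇒* 0≤x (<⇒≤ (x<0⇒0<-x y<0))) ≤-refl ⟩
  x * (- y) - x * (- y) ≈⟨ solve 1 (λ z → z :- z := con 0ℚ) refl (x * (- y)) ⟩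
  0ℝ               ∎)
  where open ≤-Reasoning

-- Natural numbers in the reals and finite sums.

fromℕ-suc : ∀ n → fromℕ (suc n) ≈ 1ℝ + fromℕ n
fromℕ-suc n = trans (reflexive (cong fromℚ suc/1)) (fromℚ-+ 1ℚ (+ n ℚ./ 1))
  where
  n/1 = ℚᵘ.mkℚᵘ (+ n) 0
  -- Division normalises by a gcd and does not compute on a variable, so the identity is checked on
  -- unnormalised fractions.
  suc/1 : + suc n ℚ./ 1 ≡ 1ℚ ℚ.+ + n ℚ./ 1
  suc/1 = ℚ.toℚᵘ-injective (begin-equality
    ℚ.toℚᵘ (ℚ.fromℚᵘ (ℚᵘ.mkℚᵘ (+ suc n) 0))  ≃⟨ ℚ.toℚᵘ-fromℚᵘ (ℚᵘ.mkℚᵘ (+ suc n) 0) ⟩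
    ℚᵘ.mkℚᵘ (+ suc n) 0
      ≃⟨ ℚᵘ.*≡* (cong (ℤ._* + 1) (cong (ℤ._+_ ℤ.1ℤ) (≡.sym (ℤ.*-identityʳ (+ n))))) ⟩
    ℚᵘ.1ℚᵘ ℚᵘ.+ n/1                          ≃⟨ ℚᵘ.+-congʳ ℚᵘ.1ℚᵘ (ℚ.toℚᵘ-fromℚᵘ n/1) ⟨
    ℚᵘ.1ℚᵘ ℚᵘ.+ ℚ.toℚᵘ (ℚ.fromℚᵘ n/1)        ≃⟨ ℚ.toℚᵘ-homo-+ 1ℚ (ℚ.fromℚᵘ n/1) ⟨
    ℚ.toℚᵘ (1ℚ ℚ.+ + n ℚ./ 1)                ∎)
    where open ℚᵘ.≤-Reasoning

fromℕ-+ : ∀ m n → fromℕ (m ℕ.+ n) ≈ fromℕ m + fromℕ n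
fromℕ-+ zero    n = sym (+-identityˡ (fromℕ n))
fromℕ-+ (suc m) n = begin
  fromℕ (suc (m ℕ.+ n))      ≈⟨ fromℕ-suc (m ℕ.+ n) ⟩
  1ℝ + fromℕ (m ℕ.+ n)       ≈⟨ +-congˡ (fromℕ-+ m n) ⟩
  1ℝ + (fromℕ m + fromℕ n)   ≈⟨ solve 3 (λ a b c → a :+ (b :+ c) := (a :+ b) :+ c) refl _ _ _ ⟩
  (1ℝ + fromℕ m) + fromℕ n   ≈⟨ +-congʳ (fromℕ-suc m) ⟨
  fromℕ (suc m) + fromℕ n    ∎
  where open ≈-Reasoning

0≤fromℕ : ∀ n → 0ℝ ≤ fromℕ n
0≤fromℕ zero    = ≤-refl
0≤fromℕ (suc n) = ≤-trans (0≤⇒+ (<⇒≤ 0<1) (0≤fromℕ n)) (≤-reflexive (sym (fromℕ-suc n)))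

fromℕ-mono-≤ : ∀ {m n} → m ℕ.≤ n → fromℕ m ≤ fromℕ n
fromℕ-mono-≤ {n = n} ℕ.z≤n = 0≤fromℕ n
fromℕ-mono-≤ {suc m} {suc n} (ℕ.s≤s m≤n) = begin
  fromℕ (suc m)   ≈⟨ fromℕ-suc m ⟩
  1ℝ + fromℕ m    ≲⟨ +-mono-≤ ≤-refl (fromℕ-mono-≤ m≤n) ⟩
  1ℝ + fromℕ n    ≈⟨ fromℕ-suc n ⟨
  fromℕ (suc n)   ∎
  where open ≤-Reasoning

sum-const : ∀ n x → ∑[ i < n ] x ≈ fromℕ n * x
sum-const zero    x = sym (zeroˡ x)
sum-const (suc n) x = begin
  x + ∑[ i < n ] x     ≈⟨ +-congˡ (sum-const n x) ⟩
  x + fromℕ n * x      ≈⟨ solve 2 (λ x k → x :+ k :* x := (con 1ℚ :+ k) :* x) refl x (fromℕ n) ⟩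
  (1ℝ + fromℕ n) * x   ≈⟨ *-congʳ (fromℕ-suc n) ⟨
  fromℕ (suc n) * x    ∎
  where open ≈-Reasoning

sum-zero : ∀ {n} {f : Vector ℝ n} → (∀ i → f i ≈ 0ℝ) → sum f ≈ 0ℝ
sum-zero {n} f≈0 = trans (sum-cong-≋ f≈0) (sum-replicate-zero n)

sum-mono-≤ : ∀ {n} {f g : Vector ℝ n} → (∀ i → f i ≤ g i) → sum f ≤ sum g
sum-mono-≤ {zero}  f≤g = ≤-refl
sum-mono-≤ {suc n} f≤g = +-mono-≤ (f≤g zero) (sum-mono-≤ (λ i → f≤g (suc i)))

0≤sum : ∀ {n} {f : Vector ℝ n} → (∀ i → 0ℝ ≤ f i) → 0ℝ ≤ sum f
0≤sum {zero}  0≤f = ≤-refl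
0≤sum {suc n} 0≤f = 0≤⇒+ (0≤f zero) (0≤sum (λ i → 0≤f (suc i)))

0<sum : ∀ {n} {f : Vector ℝ n} i → 0ℝ < f i → (∀ i → 0ℝ ≤ f i) → 0ℝ < sum f
0<sum zero    0<fi 0≤f = 0<⇒+ˡ 0<fi (0≤sum (λ i → 0≤f (suc i)))
0<sum {f = f} (suc i) 0<fi 0≤f =
  <-≤-trans (0<sum i 0<fi (λ i → 0≤f (suc i)))
    (≤-trans (≤-reflexive (sym (+-identityˡ _))) (+-mono-≤ (0≤f zero) ≤-refl))

sum-single : ∀ {n} {f : Vector ℝ n} k → (∀ i → i ≢ k → f i ≈ 0ℝ) → sum f ≈ f k
sum-single {f = f} zero f≈0 =
  trans (+-congˡ (sum-zero λ i → f≈0 (suc i) λ ())) (+-identityʳ (f zero))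
sum-single {f = f} (suc k) f≈0 = trans
  (+-cong (f≈0 zero λ ()) (sum-single k λ i i≢k → f≈0 (suc i) λ eq → i≢k (Fin.suc-injective eq)))
  (+-identityˡ _)

-- Dot products and homogeneous linear systems.

dot : ∀ {n} → Vector ℝ n → Vector ℝ n → ℝ
dot {n} u v = ∑[ i < n ] (u i * v i)

combination : ∀ {m n} → Vector ℝ m → Vector (Vector ℝ n) m → Vector ℝ n
combination {m} a z i = ∑[ k < m ] (a k * z k i)

dot-comm : ∀ {n} (u v : Vector ℝ n) → dot u v ≈ dot v u
dot-comm u v = sum-cong-≋ λ i → *-comm (u i) (v i)

dot-zeroʳ : ∀ {n} (u : Vector ℝ n) {v} → (∀ i → v i ≈ 0ℝ) → dot u v ≈ 0ℝ
dot-zeroʳ u v≈0 = sum-zero λ i → trans (*-congˡ (v≈0 i)) (zeroʳ (u i))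

dot-linearˡ : ∀ {n} α γ (u v x : Vector ℝ n) →
              dot (λ i → α * u i + γ * v i) x ≈ α * dot u x + γ * dot v x
dot-linearˡ {n} α γ u v x = begin
  ∑[ i < n ] ((α * u i + γ * v i) * x i)
    ≈⟨ sum-cong-≋ (λ i → solve 5 (λ α γ u v x → (α :* u :+ γ :* v) :* x := α :* (u :* x) :+ γ :* (v :* x))
                     refl α γ (u i) (v i) (x i)) ⟩
  ∑[ i < n ] (α * (u i * x i) + γ * (v i * x i))
    ≈⟨ ∑-distrib-+ (λ i → α * (u i * x i)) (λ i → γ * (v i * x i)) ⟩
  ∑[ i < n ] (α * (u i * x i)) + ∑[ i < n ] (γ * (v i * x i))
    ≈⟨ +-cong (*-distribˡ-sum α (λ i → u i * x i)) (*-distribˡ-sum γ (λ i → v i * x i)) ⟨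
  α * dot u x + γ * dot v x ∎
  where open ≈-Reasoning

dot-linearʳ : ∀ {n} α γ (x u v : Vector ℝ n) →
              dot x (λ i → α * u i + γ * v i) ≈ α * dot x u + γ * dot x v
dot-linearʳ α γ x u v = begin
  dot x (λ i → α * u i + γ * v i)  ≈⟨ dot-comm x _ ⟩
  dot (λ i → α * u i + γ * v i) x  ≈⟨ dot-linearˡ α γ u v x ⟩
  α * dot u x + γ * dot v x        ≈⟨ +-cong (*-congˡ (dot-comm u x)) (*-congˡ (dot-comm v x)) ⟩
  α * dot x u + γ * dot x v        ∎
  where open ≈-Reasoning

dot-scaleʳ : ∀ {n} (u : Vector ℝ n) α v → dot u (λ i → α * v i) ≈ α * dot u v
dot-scaleʳ {n} u α v = trans
  (sum-cong-≋ λ i → solve 3 (λ u a v → u :* (a :* v) := a :* (u :* v)) refl (u i) α (v i))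
  (sym (*-distribˡ-sum α (λ i → u i * v i)))

dot-combination : ∀ {m n} (v : Vector ℝ n) (a : Vector ℝ m) z →
                  dot v (combination a z) ≈ ∑[ k < m ] (a k * dot v (z k))
dot-combination {m} {n} v a z = begin
  ∑[ i < n ] (v i * ∑[ k < m ] (a k * z k i))
    ≈⟨ sum-cong-≋ (λ i → *-distribˡ-sum (v i) (λ k → a k * z k i)) ⟩
  ∑[ i < n ] ∑[ k < m ] (v i * (a k * z k i))
    ≈⟨ ∑-comm (λ i k → v i * (a k * z k i)) ⟩
  ∑[ k < m ] dot v (λ i → a k * z k i)
    ≈⟨ sum-cong-≋ (λ k → dot-scaleʳ v (a k) (z k)) ⟩
  ∑[ k < m ] (a k * dot v (z k)) ∎
  where open ≈-Reasoning

e-diag : ∀ {n} (j : Fin n) → e j j ≈ 1ℝ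
e-diag j with j Fin.≟ j
... | yes _  = refl
... | no j≢j = contradiction ≡.refl j≢j

e-off : ∀ {n} {i j : Fin n} → i ≢ j → e i j ≈ 0ℝ
e-off {i = i} {j} i≢j with i Fin.≟ j
... | yes i≡j = contradiction i≡j i≢j
... | no _    = refl

dot-e : ∀ {n} (v : Vector ℝ n) j → dot v (e j) ≈ v j
dot-e v j = begin
  dot v (e j)    ≈⟨ sum-single j (λ i i≢j → trans (*-congˡ (e-off (λ j≡i → i≢j (≡.sym j≡i)))) (zeroʳ (v i))) ⟩
  v j * e j j    ≈⟨ *-congˡ (e-diag j) ⟩
  v j * 1ℝ       ≈⟨ *-identityʳ (v j) ⟩
  v j            ∎
  where open ≈-Reasoning

-- Apartness from zero with a witnessing coordinate. The square spares a choice of sign and is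
-- directly a positive term in a sum of squares.
Nonzero : ∀ {n} → Vector ℝ n → Set
Nonzero x = ∃[ i ] 0ℝ < x i * x i

zero-or-nonzero : ∀ {n} (x : Vector ℝ n) → ¬ ¬ ((∀ i → x i ≈ 0ℝ) ⊎ Nonzero x)
zero-or-nonzero {zero}  x = pure (inj₁ λ ())
zero-or-nonzero {suc n} x = 0-or-0<² (x zero) >>= λ where
  (inj₂ 0<x₀²) → pure (inj₂ (zero , 0<x₀²))
  (inj₁ x₀≈0)  → zero-or-nonzero (tail x) >>= λ where
    (inj₁ xs≈0)     → pure (inj₁ λ { zero → x₀≈0 ; (suc i) → xs≈0 i })
    (inj₂ (i , 0<)) → pure (inj₂ (suc i , 0<))

-- Gaussian elimination of the first coordinate.
kernel : ∀ {m n} → m ℕ.< n → (a : Vector (Vector ℝ n) m) →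
         ¬ ¬ (∃[ x ] (Nonzero x × ∀ k → dot (a k) x ≈ 0ℝ))
kernel {m} {suc n} m<n a = zero-or-nonzero (λ k → a k zero) >>= λ where
    (inj₁ column≈0)  → pure (e zero , (zero , 0<1*1) , λ k → trans (dot-e (a k) zero) (column≈0 k))
    (inj₂ (k , 0<p²)) → eliminate m<n a k 0<p²
  where
  0<1*1 : 0ℝ < e {suc n} zero zero * e {suc n} zero zero
  0<1*1 = 0<⇒0<² 0<1
  eliminate : ∀ {m} → m ℕ.< suc n → (a : Vector (Vector ℝ (suc n)) m) → ∀ k → 0ℝ < a k zero * a k zero →
              ¬ ¬ (∃[ x ] (Nonzero x × ∀ k → dot (a k) x ≈ 0ℝ))
  eliminate {suc m} m<n a k 0<p² =
    kernel (ℕ.≤-pred m<n) (λ j → reduced (punchIn k j)) >>= λ (x , (i , 0<xᵢ²) , killed) →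
    pure ( lift x
         , (suc i , <-respʳ-≈ (solve 2 (λ p x → (p :* p) :* (x :* x) := (p :* x) :* (p :* x)) refl p (x i))
                      (*-pos 0<p² 0<xᵢ²))
         , vanish x killed )
    where
    p = a k zero
    reduced : Vector (Vector ℝ n) (suc m)
    reduced j i = a j zero * a k (suc i) + (- p) * a j (suc i)
    -- Multiplying the other coordinates by the pivot solves equation `k` for the first coordinate
    -- without a division.
    lift : Vector ℝ n → Vector ℝ (suc n)
    lift x = (- dot (tail (a k)) x) ∷ (λ i → p * x i)
    dot-lift : ∀ x j → dot (a j) (lift x) ≈ - (a j zero * dot (tail (a k)) x + (- p) * dot (tail (a j)) x)
    dot-lift x j = trans (+-congˡ (dot-scaleʳ (tail (a j)) p x))
      (solve 4 (λ q s p t → q :* (:- s) :+ p :* t := :- (q :* s :+ (:- p) :* t)) refl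
         (a j zero) (dot (tail (a k)) x) p (dot (tail (a j)) x))
    vanish : ∀ x → (∀ j → dot (reduced (punchIn k j)) x ≈ 0ℝ) → ∀ j → dot (a j) (lift x) ≈ 0ℝ
    vanish x killed j with k Fin.≟ j
    ... | yes ≡.refl = trans (dot-lift x k)
            (solve 2 (λ p s → :- (p :* s :+ (:- p) :* s) := con 0ℚ) refl p (dot (tail (a k)) x))
    ... | no k≢j = begin
      dot (a j) (lift x)
        ≈⟨ dot-lift x j ⟩
      - (a j zero * dot (tail (a k)) x + (- p) * dot (tail (a j)) x)
        ≈⟨ -‿cong (dot-linearˡ (a j zero) (- p) (tail (a k)) (tail (a j)) x) ⟨
      - dot (reduced j) x
        ≈⟨ -‿cong (subst (λ j → dot (reduced j) x ≈ 0ℝ) (Fin.punchIn-punchOut k≢j) (killed (punchOut k≢j))) ⟩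
      - 0ℝ
        ≈⟨ solve 0 (:- con 0ℚ := con 0ℚ) refl ⟩
      0ℝ ∎
      where open ≈-Reasoning

-- Symmetric forms and orthogonal frames.

-- An operator in place of a matrix: `op B u` is the row that expresses B-orthogonality to `u` as a
-- dot product, the shape of equation that `kernel` solves. Linearity in the second argument is that
-- of `dot`; in the first it follows from self-adjointness.
record SymForm (n : ℕ) : Set where
  field
    op         : Vector ℝ n → Vector ℝ n
    op-selfadj : ∀ u v → dot (op u) v ≈ dot (op v) u

open SymForm public using (op; op-selfadj)

infix 9 _⟪_,_⟫
_⟪_,_⟫ : ∀ {n} → SymForm n → Vector ℝ n → Vector ℝ n → ℝ
B ⟪ u , v ⟫ = dot (op B u) v

-- The double negation makes room for Gram forms, where whether a combination vanishes is decided
-- only inside it.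
PosDef : ∀ {n} → SymForm n → Set
PosDef B = ∀ x → Nonzero x → ¬ ¬ (0ℝ < B ⟪ x , x ⟫)

form-zero : ∀ {n} (B : SymForm n) u {x} → (∀ i → x i ≈ 0ℝ) → B ⟪ u , x ⟫ ≈ 0ℝ
form-zero B u = dot-zeroʳ (op B u)

-- The vectors √cₖ zₖ are orthonormal for B; weights cₖ replace square roots.
record Frame {n s} (B : SymForm n) (F : Vector (Vector ℝ n) s) (m : ℕ) : Set where
  field
    vec        : Vector (Vector ℝ n) m
    weight     : Vector ℝ m
    weight≥0   : ∀ k → 0ℝ ≤ weight k
    orthogonal : ∀ j k → j ≢ k → B ⟪ vec j , vec k ⟫ ≈ 0ℝ
    normalised : ∀ k → weight k * B ⟪ vec k , vec k ⟫ ≈ 1ℝ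
    killed     : ∀ f k → dot (F f) (vec k) ≈ 0ℝ

open Frame

record Adjoinable {n s} {B : SymForm n} {F : Vector (Vector ℝ n) s} {m}
                  (φ : Frame B F m) (x : Vector ℝ n) : Set where
  field
    positive   : 0ℝ < B ⟪ x , x ⟫
    orthogonal : ∀ k → B ⟪ vec φ k , x ⟫ ≈ 0ℝ
    killed     : ∀ f → dot (F f) x ≈ 0ℝ

adjoin : ∀ {n s} {B : SymForm n} {F : Vector (Vector ℝ n) s} {m} (φ : Frame B F m) {x} →
         Adjoinable φ x → Frame B F (suc m)
adjoin {B = B} φ {x} adj = record
  { vec        = x ∷ vec φ
  ; weight     = recip B⟪x,x⟫ positive ∷ weight φ
  ; weight≥0   = λ { zero    → 0≤-inverse (<⇒≤ positive) (*-recip B⟪x,x⟫ positive)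
                   ; (suc k) → weight≥0 φ k }
  ; orthogonal = λ { zero    zero    0≢0 → contradiction ≡.refl 0≢0
                   ; zero    (suc k) _   → trans (op-selfadj B x (vec φ k)) (x⊥ k)
                   ; (suc j) zero    _   → x⊥ j
                   ; (suc j) (suc k) j≢k → orthogonal φ j k (λ eq → j≢k (cong suc eq)) }
  ; normalised = λ { zero    → trans (*-comm _ _) (*-recip B⟪x,x⟫ positive)
                   ; (suc k) → normalised φ k }
  ; killed     = λ { f zero → x-killed f ; f (suc k) → killed φ f k }
  }
  where
  open Adjoinable adj using (positive) renaming (orthogonal to x⊥; killed to x-killed)
  B⟪x,x⟫ = B ⟪ x , x ⟫

-- Gram-Schmidt without projections: the `s` rows of `F` and the `m` orthogonality conditions are
-- fewer than `n` equations, so they have a nonzero common solution.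
adjoinable : ∀ {n s} {B : SymForm n} {F : Vector (Vector ℝ n) s} {m} → PosDef B → (φ : Frame B F m) →
             s ℕ.+ m ℕ.< n → ¬ ¬ (∃[ x ] Adjoinable φ x)
adjoinable {s = s} {B} {F} {m} B>0 φ s+m<n =
  kernel s+m<n (F ++ λ k → op B (vec φ k)) >>= λ (x , x≢0 , x-killed) →
  B>0 x x≢0 >>= λ 0<⟪x,x⟫ →
  pure (x , record
    { positive   = 0<⟪x,x⟫
    ; orthogonal = λ k → subst (λ u → dot u x ≈ 0ℝ)
                     (Vector.lookup-++ʳ F (λ k → op B (vec φ k)) k) (x-killed (s ↑ʳ k))
    ; killed     = λ f → subst (λ u → dot u x ≈ 0ℝ)
                     (Vector.lookup-++ˡ F (λ k → op B (vec φ k)) f) (x-killed (f ↑ˡ m))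
    })

frame-of-size : ∀ {n s} {B : SymForm n} {F : Vector (Vector ℝ n) s} → PosDef B →
                ∀ m → s ℕ.+ m ℕ.≤ n → ¬ ¬ Frame B F m
frame-of-size B>0 zero _ = pure (record
  { vec = [] ; weight = [] ; weight≥0 = λ () ; orthogonal = λ () ; normalised = λ () ; killed = λ _ () })
frame-of-size {n} {s} B>0 (suc m) s+1+m≤n =
  frame-of-size B>0 m (ℕ.≤-trans (ℕ.n≤1+n _) s+m<n) >>= λ φ →
  adjoinable B>0 φ s+m<n >>= λ (x , adj) →
  pure (adjoin φ adj)
  where
  s+m<n : s ℕ.+ m ℕ.< n
  s+m<n = subst (ℕ._≤ n) (ℕ.+-suc s m) s+1+m≤n

-- More than `n` vectors satisfy a linear relation with some coefficient apart from zero. Pairing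
-- the relation with that vector of the frame isolates the coefficient and shows that it vanishes.
frame-size : ∀ {n s} {B : SymForm n} {F : Vector (Vector ℝ n) s} {m} → Frame B F m → m ℕ.≤ n
frame-size {n} {B = B} {m = m} φ = ℕ.≮⇒≥ λ n<m → kernel n<m (λ i k → vec φ k i)
  λ (a , (k , 0<aₖ²) , dependent) →
    let aₖ≈0 : a k ≈ 0ℝ
        aₖ≈0 = begin
          a k                                                  ≈⟨ *-identityʳ (a k) ⟨
          a k * 1ℝ                                             ≈⟨ *-congˡ (normalised φ k) ⟨
          a k * (weight φ k * B ⟪ vec φ k , vec φ k ⟫)
            ≈⟨ solve 3 (λ a c b → a :* (c :* b) := c :* (a :* b)) refl _ _ _ ⟩
          weight φ k * (a k * B ⟪ vec φ k , vec φ k ⟫)         ≈⟨ *-congˡ (sum-single k λ j j≢k →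
                                                                    trans (*-congˡ (orthogonal φ k j (λ eq → j≢k (≡.sym eq)))) (zeroʳ (a j))) ⟨
          weight φ k * ∑[ j < m ] (a j * B ⟪ vec φ k , vec φ j ⟫)
            ≈⟨ *-congˡ (dot-combination (op B (vec φ k)) a (vec φ)) ⟨
          weight φ k * B ⟪ vec φ k , combination a (vec φ) ⟫
            ≈⟨ *-congˡ (form-zero B (vec φ k) λ i → trans (dot-comm a (λ k → vec φ k i)) (dependent i)) ⟩
          weight φ k * 0ℝ                                      ≈⟨ zeroʳ (weight φ k) ⟩
          0ℝ                                                   ∎
    in <⇒≱ 0<aₖ² (≤-reflexive (trans (*-congʳ aₖ≈0) (zeroˡ (a k))))
  where
  open ≈-Reasoning

-- If `x` were nonzero it could be adjoined, giving a frame of n + 1 vectors against `frame-size`.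
basis-⊥ : ∀ {n} {B : SymForm n} → PosDef B → (φ : Frame B [] n) →
          ∀ {x} → (∀ k → B ⟪ vec φ k , x ⟫ ≈ 0ℝ) → ∀ i → x i ≈ 0ℝ
basis-⊥ B>0 φ {x} ⊥x i = ≈-stable (zero-or-nonzero x >>= λ where
  (inj₁ x≈0) → pure (x≈0 i)
  (inj₂ x≢0) → B>0 x x≢0 >>= λ 0<⟪x,x⟫ → contradiction
    (frame-size (adjoin φ (record { positive = 0<⟪x,x⟫ ; orthogonal = ⊥x ; killed = λ () })))
    (ℕ.<⇒≱ ℕ.≤-refl))

diagForm : ∀ {n} → Vector ℝ n → SymForm n
diagForm d = record
  { op         = λ u i → d i * u i
  ; op-selfadj = λ u v → sum-cong-≋ λ i →
      solve 3 (λ d u v → d :* u :* v := d :* v :* u) refl (d i) (u i) (v i)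
  }

diagForm-posDef : ∀ {n} {d : Vector ℝ n} → (∀ i → 0ℝ < d i) → PosDef (diagForm d)
diagForm-posDef {d = d} 0<d x (i , 0<xᵢ²) = pure (0<sum i
  (<-respʳ-≈ (sym (*-assoc _ _ _)) (*-pos (0<d i) 0<xᵢ²))
  (λ j → ≤-trans (0≤⇒* (<⇒≤ (0<d j)) (0≤² (x j))) (≤-reflexive (sym (*-assoc _ _ _)))))

-- Quadratic forms of matrices.

quad : ∀ {n} → Matrix n → Vector ℝ n → ℝ
quad {n} A x = ∑[ i < n ] ∑[ j < n ] (x i * A i j * x j)

apply : ∀ {n} → Matrix n → Vector ℝ n → Vector ℝ n
apply {n} A u j = ∑[ i < n ] (u i * A i j)

dot-apply : ∀ {n} (A : Matrix n) u v → dot (apply A u) v ≈ ∑[ i < n ] ∑[ j < n ] (u i * A i j * v j)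
dot-apply A u v = trans
  (sum-cong-≋ λ j → *-distribʳ-sum (v j) (λ i → u i * A i j))
  (∑-comm λ j i → u i * A i j * v j)

matForm : ∀ {n} (A : Matrix n) → (∀ i j → A i j ≈ A j i) → SymForm n
matForm {n} A A-sym = record { op = apply A ; op-selfadj = selfadj }
  where
  open ≈-Reasoning
  selfadj : ∀ u v → dot (apply A u) v ≈ dot (apply A v) u
  selfadj u v = begin
    dot (apply A u) v                            ≈⟨ dot-apply A u v ⟩
    ∑[ i < n ] ∑[ j < n ] (u i * A i j * v j)    ≈⟨ ∑-comm (λ i j → u i * A i j * v j) ⟩
    ∑[ j < n ] ∑[ i < n ] (u i * A i j * v j)    ≈⟨ sum-cong-≋ (λ j → sum-cong-≋ λ i → trans
                                                      (*-congʳ (*-congˡ (A-sym i j)))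
                                                      (solve 3 (λ u a v → u :* a :* v := v :* a :* u) refl (u i) (A j i) (v j))) ⟩
    ∑[ j < n ] ∑[ i < n ] (v j * A j i * u i)    ≈⟨ dot-apply A v u ⟨
    dot (apply A v) u                            ∎

quad-cong : ∀ {n} {A B : Matrix n} → (∀ i j → A i j ≈ B i j) → ∀ x → quad A x ≈ quad B x
quad-cong A≈B x = sum-cong-≋ λ i → sum-cong-≋ λ j → *-congʳ (*-congˡ (A≈B i j))

quad-⊕ : ∀ {n} (A B : Matrix n) x → quad (A ⊕ B) x ≈ quad A x + quad B x
quad-⊕ A B x = trans
  (sum-cong-≋ λ i → trans
    (sum-cong-≋ λ j → solve 4 (λ u a b v → u :* (a :+ b) :* v := u :* a :* v :+ u :* b :* v)
                        refl (x i) (A i j) (B i j) (x j))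
    (∑-distrib-+ (λ j → x i * A i j * x j) (λ j → x i * B i j * x j)))
  (∑-distrib-+ (λ i → sum λ j → x i * A i j * x j) (λ i → sum λ j → x i * B i j * x j))

quad-· : ∀ {n} c (A : Matrix n) x → quad (c · A) x ≈ c * quad A x
quad-· c A x = trans
  (sum-cong-≋ λ i → trans
    (sum-cong-≋ λ j → solve 4 (λ c u a v → u :* (c :* a) :* v := c :* (u :* a :* v))
                        refl c (x i) (A i j) (x j))
    (sym (*-distribˡ-sum c (λ j → x i * A i j * x j))))
  (sym (*-distribˡ-sum c (λ i → sum λ j → x i * A i j * x j)))

quad-⊖ : ∀ {n} (A B : Matrix n) x → quad (A ⊖ B) x ≈ quad A x - quad B x
quad-⊖ A B x = begin
  quad (A ⊖ B) x
    ≈⟨ quad-cong (λ i j → solve 2 (λ a b → a :- b := a :+ (:- con 1ℚ) :* b) refl (A i j) (B i j)) x ⟩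
  quad (A ⊕ (- 1ℝ) · B) x         ≈⟨ quad-⊕ A ((- 1ℝ) · B) x ⟩
  quad A x + quad ((- 1ℝ) · B) x  ≈⟨ +-congˡ (quad-· (- 1ℝ) B x) ⟩
  quad A x + (- 1ℝ) * quad B x    ≈⟨ solve 2 (λ a b → a :+ (:- con 1ℚ) :* b := a :- b) refl (quad A x) (quad B x) ⟩
  quad A x - quad B x             ∎
  where open ≈-Reasoning

quad-∑ᴹ : ∀ {m n} (A : Vector (Matrix n) m) x → quad (∑ᴹ A) x ≈ ∑[ k < m ] quad (A k) x
quad-∑ᴹ {zero}  A x = sum-zero λ i → sum-zero λ j → solve 2 (λ u v → u :* con 0ℚ :* v := con 0ℚ) refl (x i) (x j)
quad-∑ᴹ {suc m} A x = trans (quad-⊕ (head A) (∑ᴹ (tail A)) x) (+-congˡ (quad-∑ᴹ (tail A) x))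

quad-outer : ∀ {n} (v : Vector ℝ n) x → quad (outer v) x ≈ dot v x * dot v x
quad-outer v x = trans
  (sum-cong-≋ λ i → trans
    (sum-cong-≋ λ j → solve 4 (λ u a b v → u :* (a :* b) :* v := (a :* u) :* (b :* v)) refl (x i) (v i) (v j) (x j))
    (sym (*-distribˡ-sum (v i * x i) (λ j → v j * x j))))
  (sym (*-distribʳ-sum (dot v x) (λ i → v i * x i)))

quad-diagonal : ∀ {n} (A : Matrix n) → (∀ i j → j ≢ i → A i j ≈ 0ℝ) →
                ∀ x → quad A x ≈ ∑[ i < n ] (A i i * (x i * x i))
quad-diagonal A off x = sum-cong-≋ λ i → trans
  (sum-single i λ j j≢i → trans (*-congʳ (trans (*-congˡ (off i j j≢i)) (zeroʳ (x i)))) (zeroˡ (x j)))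
  (solve 2 (λ a u → u :* a :* u := a :* (u :* u)) refl (A i i) (x i))

quad-e : ∀ {n} (A : Matrix n) i → quad A (e i) ≈ A i i
quad-e {n} A i = begin
  quad A (e i)               ≈⟨ dot-apply A (e i) (e i) ⟨
  dot (apply A (e i)) (e i)  ≈⟨ dot-e (apply A (e i)) i ⟩
  dot (e i) (λ k → A k i)    ≈⟨ dot-comm (e i) _ ⟩
  dot (λ k → A k i) (e i)    ≈⟨ dot-e (λ k → A k i) i ⟩
  A i i                      ∎
  where open ≈-Reasoning

-- Traces relative to a diagonal form.

module _ {n} {d ρ : Vector ℝ n} (0<d : ∀ i → 0ℝ < d i) (dρ≈1 : ∀ i → d i * ρ i ≈ 1ℝ) where

  -- The error of the expansion of eⱼ is orthogonal to the whole basis.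
  basis-expansion : (φ : Frame (diagForm d) [] n) → ∀ i j →
                    ∑[ k < n ] ((weight φ k * (d j * vec φ k j)) * vec φ k i) ≈ e j i
  basis-expansion φ i j = begin
    combination a (vec φ) i
      ≈⟨ solve 2 (λ s t → s := t :- (con 1ℚ :* t :+ (:- con 1ℚ) :* s)) refl _ (e j i) ⟩
    e j i - remainder i                      ≈⟨ +-congˡ (-‿cong (basis-⊥ (diagForm-posDef 0<d) φ ⊥remainder i)) ⟩
    e j i - 0ℝ                               ≈⟨ solve 1 (λ t → t :- con 0ℚ := t) refl (e j i) ⟩
    e j i                                    ∎
    where
    open ≈-Reasoning
    -- Fourier coefficients of `e j`: pairing it with `vec φ k` under the form gives
    -- `d j * vec φ k j`.
    a : Vector ℝ n
    a k = weight φ k * (d j * vec φ k j)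
    remainder : Vector ℝ n
    remainder i = 1ℝ * e j i + (- 1ℝ) * combination a (vec φ) i
    B = diagForm d
    ⊥remainder : ∀ l → B ⟪ vec φ l , remainder ⟫ ≈ 0ℝ
    ⊥remainder l = begin
      B ⟪ z , remainder ⟫
        ≈⟨ dot-linearʳ 1ℝ (- 1ℝ) (op B z) (e j) (combination a (vec φ)) ⟩
      1ℝ * B ⟪ z , e j ⟫ + (- 1ℝ) * B ⟪ z , combination a (vec φ) ⟫
        ≈⟨ +-cong (*-congˡ (dot-e (op B z) j)) (*-congˡ (trans (dot-combination (op B z) a (vec φ))
             (sum-single l λ k k≢l → trans (*-congˡ (orthogonal φ l k (λ eq → k≢l (≡.sym eq)))) (zeroʳ (a k))))) ⟩
      1ℝ * (d j * z j) + (- 1ℝ) * (a l * B ⟪ z , z ⟫)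
        ≈⟨ solve 3 (λ c y b → con 1ℚ :* y :+ (:- con 1ℚ) :* (c :* y :* b) := y :- y :* (c :* b)) refl (weight φ l) (d j * z j) (B ⟪ z , z ⟫) ⟩
      d j * z j - d j * z j * (weight φ l * B ⟪ z , z ⟫)
        ≈⟨ +-congˡ (-‿cong (*-congˡ (normalised φ l))) ⟩
      d j * z j - d j * z j * 1ℝ
        ≈⟨ solve 1 (λ y → y :- y :* con 1ℚ := con 0ℚ) refl (d j * z j) ⟩
      0ℝ ∎
      where z = vec φ l

  -- With D = diag(d), the expansion of the standard basis says Σ cₖ zₖ zₖᵀ = D⁻¹. Both sides are
  -- therefore the trace of A D⁻¹.
  basis-trace : (φ : Frame (diagForm d) [] n) (A : Matrix n) →
                ∑[ k < n ] (weight φ k * quad A (vec φ k)) ≈ ∑[ i < n ] (A i i * ρ i)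
  basis-trace φ A = begin
    ∑[ k < n ] (c k * quad A (z k))
      ≈⟨ sum-cong-≋ (λ k → trans (*-distribˡ-sum (c k) (λ i → sum λ j → z k i * A i j * z k j))
           (sum-cong-≋ λ i → trans (*-distribˡ-sum (c k) (λ j → z k i * A i j * z k j))
             (sum-cong-≋ λ j → rescale k i j))) ⟩
    ∑[ k < n ] ∑[ i < n ] ∑[ j < n ] term i j k
      ≈⟨ ∑-comm (λ k i → ∑[ j < n ] term i j k) ⟩
    ∑[ i < n ] ∑[ k < n ] ∑[ j < n ] term i j k
      ≈⟨ sum-cong-≋ (λ i → ∑-comm (λ k j → term i j k)) ⟩
    ∑[ i < n ] ∑[ j < n ] ∑[ k < n ] term i j k
      ≈⟨ sum-cong-≋ (λ i → sum-cong-≋ λ j → trans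
           (sym (*-distribˡ-sum (A i j * ρ j) (λ k → (c k * (d j * z k j)) * z k i)))
           (*-congˡ (basis-expansion φ i j))) ⟩
    ∑[ i < n ] ∑[ j < n ] ((A i j * ρ j) * e j i)
      ≈⟨ sum-cong-≋ (λ i → trans
           (sum-single i λ j j≢i → trans (*-congˡ (e-off j≢i)) (zeroʳ (A i j * ρ j)))
           (trans (*-congˡ (e-diag i)) (*-identityʳ (A i i * ρ i)))) ⟩
    ∑[ i < n ] (A i i * ρ i) ∎
    where
    open ≈-Reasoning
    c = weight φ
    z = vec φ
    term : Fin n → Fin n → Fin n → ℝ
    term i j k = (A i j * ρ j) * ((c k * (d j * z k j)) * z k i)
    -- Inserting the factor `d j * ρ j`, which is 1, turns the sum over `k` into the expansion of
    -- `e j`.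
    rescale : ∀ k i j → c k * (z k i * A i j * z k j) ≈ term i j k
    rescale k i j = begin
      c k * (z k i * A i j * z k j)
        ≈⟨ solve 4 (λ c u a v → c :* (u :* a :* v) := con 1ℚ :* (c :* (u :* a :* v))) refl (c k) (z k i) (A i j) (z k j) ⟩
      1ℝ * (c k * (z k i * A i j * z k j))
        ≈⟨ *-congʳ (dρ≈1 j) ⟨
      (d j * ρ j) * (c k * (z k i * A i j * z k j))
        ≈⟨ solve 6 (λ d r c u a v → (d :* r) :* (c :* (u :* a :* v)) := (a :* r) :* ((c :* (d :* v)) :* u))
             refl (d j) (ρ j) (c k) (z k i) (A i j) (z k j) ⟩
      term i j k ∎

  -- Completing the frame to a basis only adds nonnegative terms.
  trace-bound : ∀ r {m} → r ℕ.+ m ≡ n → (φ : Frame (diagForm d) [] m) {A : Matrix n} → PSD A →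
                ∑[ k < m ] (weight φ k * quad A (vec φ k)) ≤ ∑[ i < n ] (A i i * ρ i)
  trace-bound zero    ≡.refl φ {A} _ = ≤-reflexive (basis-trace φ A)
  trace-bound (suc r) {m} eq φ {A} A-psd = ≤-stable
    (adjoinable (diagForm-posDef 0<d) φ (subst (suc m ℕ.≤_) 1+m+r≡n (ℕ.m≤m+n (suc m) r)) >>= λ (x , adj) →
     pure (let φ⁺ = adjoin φ adj in begin
       ∑[ k < m ] (weight φ k * quad A (vec φ k))
         ≈⟨ +-identityˡ _ ⟨
       0ℝ + ∑[ k < m ] (weight φ k * quad A (vec φ k))
         ≲⟨ +-mono-≤ (0≤⇒* (weight≥0 φ⁺ zero) (PSD.nonnegative A-psd x)) ≤-refl ⟩
       ∑[ k < suc m ] (weight φ⁺ k * quad A (vec φ⁺ k))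
         ≲⟨ trace-bound r (≡.trans (ℕ.+-suc r m) eq) φ⁺ A-psd ⟩
       ∑[ i < n ] (A i i * ρ i) ∎))
    where
    open ≤-Reasoning
    1+m+r≡n : suc m ℕ.+ r ≡ n
    1+m+r≡n = ≡.trans (cong suc (ℕ.+-comm m r)) eq

-- Gram forms and families on which a form is negative.

gram-op : ∀ {n p} → SymForm n → Vector (Vector ℝ n) p → Vector ℝ p → Vector ℝ p
gram-op B y a k = B ⟪ combination a y , y k ⟫

dot-gram : ∀ {n p} (B : SymForm n) (y : Vector (Vector ℝ n) p) a b →
           dot (gram-op B y a) b ≈ B ⟪ combination a y , combination b y ⟫
dot-gram B y a b = trans (dot-comm _ b) (sym (dot-combination (op B (combination a y)) b y))

-- The pullback of `B` along a ↦ Σ aₖ yₖ. A frame found in coefficient space thus lands in the span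
-- of `y`, where the sign of Q is known.
gram : ∀ {n p} → SymForm n → Vector (Vector ℝ n) p → SymForm p
gram B y = record
  { op         = gram-op B y
  ; op-selfadj = λ a b → trans (dot-gram B y a b)
      (trans (op-selfadj B (combination a y) (combination b y)) (sym (dot-gram B y b a)))
  }

push-frame : ∀ {n p m} {B : SymForm n} (y : Vector (Vector ℝ n) p) → Frame (gram B y) [] m → Frame B [] m
push-frame {B = B} y φ = record
  { vec        = λ k → combination (vec φ k) y
  ; weight     = weight φ
  ; weight≥0   = weight≥0 φ
  ; orthogonal = λ j k j≢k → trans (sym (dot-gram B y (vec φ j) (vec φ k))) (orthogonal φ j k j≢k)
  ; normalised = λ k → trans (*-congˡ (sym (dot-gram B y (vec φ k) (vec φ k)))) (normalised φ k)
  ; killed     = λ ()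
  }

record NegativeFamily {n} (Q : SymForm n) (p : ℕ) : Set where
  field
    vector     : Vector (Vector ℝ n) p
    orthogonal : ∀ j k → j ≢ k → Q ⟪ vector j , vector k ⟫ ≈ 0ℝ
    negative   : ∀ k → Q ⟪ vector k , vector k ⟫ < 0ℝ

open NegativeFamily

-- As `0ℝ ≤ z` is the negation of `z < 0ℝ`, this says that no further vector can be adjoined to the
-- family.
Maximal : ∀ {n} {Q : SymForm n} {p} → NegativeFamily Q p → Set
Maximal {Q = Q} y = ∀ x → (∀ k → Q ⟪ vector y k , x ⟫ ≈ 0ℝ) → 0ℝ ≤ Q ⟪ x , x ⟫

-- The number `r` of missing vectors bounds the search. A family of `n` vectors is returned as it
-- is: then n ≤ ℓ + p, and the final estimate follows from the bound on `p`.
maximal-family : ∀ {n} {Q : SymForm n} r {p} → r ℕ.+ p ≡ n → NegativeFamily Q p →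
                 ¬ ¬ (∃[ p ] ∃ λ (y : NegativeFamily Q p) → p ≡ n ⊎ Maximal y)
maximal-family         zero    {p} p≡n y = pure (p , y , inj₁ p≡n)
-- The proposition decided is the existence of a Q-negative vector that is Q-orthogonal to the
-- family.
maximal-family {Q = Q} (suc r) {p} eq y = ¬¬-excluded-middle >>= λ where
    (no ¬∃)                → pure (p , y , inj₂ λ x ⊥x → ≮⇒≥ λ Qx<0 → ¬∃ (x , ⊥x , Qx<0))
    (yes (x , ⊥x , Qx<0)) → maximal-family r (≡.trans (ℕ.+-suc r p) eq) record
      { vector     = x ∷ vector y
      ; orthogonal = λ { zero    zero    0≢0 → contradiction ≡.refl 0≢0
                       ; zero    (suc k) _   → trans (op-selfadj Q x (vector y k)) (⊥x k)
                       ; (suc j) zero    _   → ⊥x j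
                       ; (suc j) (suc k) j≢k → orthogonal y j k (λ eq → j≢k (cong suc eq)) }
      ; negative   = λ { zero → Qx<0 ; (suc k) → negative y k }
      }

module _ {n p} {Q : SymForm n} (y : NegativeFamily Q p) where

  -- Orthogonality removes the cross terms, so Q is diagonal in the coefficients. The sign is
  -- reversed to make every summand nonnegative.
  -Q-span : ∀ a → - (Q ⟪ combination a (vector y) , combination a (vector y) ⟫)
                ≈ ∑[ k < p ] ((a k * a k) * - (Q ⟪ vector y k , vector y k ⟫))
  -Q-span a = begin
    - (Q ⟪ v , v ⟫)
      ≈⟨ -‿cong (dot-combination (op Q v) a (vector y)) ⟩
    - (∑[ k < p ] (a k * Q ⟪ v , vector y k ⟫))
      ≈⟨ solve 1 (λ x → :- x := (:- con 1ℚ) :* x) refl _ ⟩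
    - 1ℝ * (∑[ k < p ] (a k * Q ⟪ v , vector y k ⟫))
      ≈⟨ *-distribˡ-sum (- 1ℝ) (λ k → a k * Q ⟪ v , vector y k ⟫) ⟩
    ∑[ k < p ] (- 1ℝ * (a k * Q ⟪ v , vector y k ⟫))
      ≈⟨ sum-cong-≋ (λ k → trans (*-congˡ (*-congˡ (coefficient k)))
           (solve 2 (λ a q → (:- con 1ℚ) :* (a :* (a :* q)) := (a :* a) :* (:- q)) refl (a k) (Q ⟪ vector y k , vector y k ⟫))) ⟩
    ∑[ k < p ] ((a k * a k) * - (Q ⟪ vector y k , vector y k ⟫)) ∎
    where
    open ≈-Reasoning
    v = combination a (vector y)
    coefficient : ∀ k → Q ⟪ v , vector y k ⟫ ≈ a k * Q ⟪ vector y k , vector y k ⟫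
    coefficient k = begin
      Q ⟪ v , vector y k ⟫                                  ≈⟨ op-selfadj Q v (vector y k) ⟩
      Q ⟪ vector y k , v ⟫                                  ≈⟨ dot-combination (op Q (vector y k)) a (vector y) ⟩
      ∑[ j < p ] (a j * Q ⟪ vector y k , vector y j ⟫)
        ≈⟨ sum-single k (λ j j≢k → trans (*-congˡ (orthogonal y k j (λ eq → j≢k (≡.sym eq)))) (zeroʳ (a j))) ⟩
      a k * Q ⟪ vector y k , vector y k ⟫                   ∎

  Q-span≤0 : ∀ a → 0ℝ ≤ - (Q ⟪ combination a (vector y) , combination a (vector y) ⟫)
  Q-span≤0 a = ≤-trans (0≤sum λ k → 0≤⇒* (0≤² (a k)) (<⇒≤ (x<0⇒0<-x (negative y k))))
                       (≤-reflexive (sym (-Q-span a)))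

  Q-span<0 : ∀ a → Nonzero a → 0ℝ < - (Q ⟪ combination a (vector y) , combination a (vector y) ⟫)
  Q-span<0 a (k , 0<aₖ²) = <-respʳ-≈ (sym (-Q-span a))
    (0<sum k (*-pos 0<aₖ² (x<0⇒0<-x (negative y k)))
             (λ k → 0≤⇒* (0≤² (a k)) (<⇒≤ (x<0⇒0<-x (negative y k)))))

  -- Positivity on the span can fail only if a nonzero `a` gives the zero combination; then Q would
  -- vanish there, whereas `Q-span<0` makes it strictly negative. So Q-negativity makes the family
  -- independent.
  gram-posDef : ∀ {B : SymForm n} → PosDef B → PosDef (gram B (vector y))
  gram-posDef {B} B>0 a a≢0 = zero-or-nonzero v >>= λ where
      (inj₂ v≢0) → B>0 v v≢0 >>= λ 0<⟪v,v⟫ → pure (<-respʳ-≈ (sym (dot-gram B (vector y) a a)) 0<⟪v,v⟫)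
      (inj₁ v≈0) → contradiction
        (≤-reflexive (trans (-‿cong (form-zero Q v v≈0)) (solve 0 (:- con 0ℚ := con 0ℚ) refl)))
        (<⇒≱ (Q-span<0 a a≢0))
    where v = combination a (vector y)

-- Where Q = r D - A is negative, A exceeds r D, and the trace of A relative to D is bounded.
negative-count : ∀ {n p} {d ρ : Vector ℝ n} {r} {A : Matrix n} {Q : SymForm n} →
  (∀ i → 0ℝ < d i) → (∀ i → d i * ρ i ≈ 1ℝ) → PSD A →
  (∀ x → Q ⟪ x , x ⟫ ≈ r * diagForm d ⟪ x , x ⟫ - quad A x) →
  NegativeFamily Q p → fromℕ p * r ≤ ∑[ i < n ] (A i i * ρ i)
negative-count {n} {p} {d} {ρ} {r} {A} {Q} 0<d dρ≈1 A-psd Q-def y = ≤-stable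
  (frame-of-size (gram-posDef y {D} (diagForm-posDef 0<d)) p ℕ.≤-refl >>= λ φ → pure (bound φ))
  where
  D = diagForm d
  open ≤-Reasoning
  bound : Frame (gram D (vector y)) [] p → fromℕ p * r ≤ ∑[ i < n ] (A i i * ρ i)
  bound φ = begin
    fromℕ p * r                          ≈⟨ sum-const p r ⟨
    ∑[ k < p ] r                         ≲⟨ sum-mono-≤ r≤ ⟩
    ∑[ k < p ] (c k * quad A (z k))      ≲⟨ trace-bound 0<d dρ≈1 (n ℕ.∸ p) (ℕ.m∸n+n≡m (frame-size ψ)) ψ A-psd ⟩
    ∑[ i < n ] (A i i * ρ i)             ∎
    where
    ψ = push-frame {B = D} (vector y) φ
    z = vec ψ
    c = weight ψ
    r≤ : ∀ k → r ≤ c k * quad A (z k)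
    r≤ k = 0≤y-x⇒x≤y (begin
      0ℝ
        -- `z k` unfolds to the combination of the family with coefficients `vec φ k`, so Q is at
        -- most 0 on it.
        ≲⟨ 0≤⇒* (weight≥0 ψ k) (Q-span≤0 y (vec φ k)) ⟩
      c k * - (Q ⟪ z k , z k ⟫)
        ≈⟨ *-congˡ (-‿cong (Q-def (z k))) ⟩
      c k * - (r * D ⟪ z k , z k ⟫ - quad A (z k))
        ≈⟨ solve 4 (λ c r x a → c :* (:- (r :* x :- a)) := c :* a :- r :* (c :* x)) refl (c k) r (D ⟪ z k , z k ⟫) (quad A (z k)) ⟩
      c k * quad A (z k) - r * (c k * D ⟪ z k , z k ⟫)
        ≈⟨ +-congˡ (-‿cong (*-congˡ (normalised ψ k))) ⟩
      c k * quad A (z k) - r * 1ℝ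
        ≈⟨ +-congˡ (-‿cong (*-identityʳ r)) ⟩
      c k * quad A (z k) - r ∎)

-- The matrices occurring in the constraint.

diagonal-psd : ∀ {n} {q : Vector ℝ n} → (∀ i → 0ℝ ≤ q i) → PSD (∑ᴹ (λ i → q i · outer (e i)))
diagonal-psd {n} {q} 0≤q = record
  { symmetric   = λ i j → sum-cong-≋ λ k → *-congˡ (*-comm (e k i) (e k j))
  ; nonnegative = λ x → ≤-trans (0≤sum λ i → 0≤⇒* (0≤q i) (0≤² (dot (e i) x)))
      (≤-reflexive (sym (quad-diag x)))
  }
  where
  quad-diag : ∀ x → quad (∑ᴹ (λ i → q i · outer (e i))) x ≈ ∑[ i < n ] (q i * (dot (e i) x * dot (e i) x))
  quad-diag x = trans (quad-∑ᴹ (λ i → q i · outer (e i)) x)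
    (sum-cong-≋ λ i → trans (quad-· (q i) (outer (e i)) x) (*-congˡ (quad-outer (e i) x)))

diagonal-entry : ∀ {n} (q : Vector ℝ n) j → ∑ᴹ (λ i → q i · outer (e i)) j j ≈ q j
diagonal-entry q j = trans
  (sum-single j λ i i≢j → trans (*-congˡ (trans (*-congʳ (e-off i≢j)) (zeroˡ (e i j)))) (zeroʳ (q i)))
  (trans (*-congˡ (*-cong (e-diag j) (e-diag j))) (solve 1 (λ x → x :* (con 1ℚ :* con 1ℚ) := x) refl (q j)))

quad-diag : ∀ {n} (A : Matrix n) x → quad (diag A) x ≈ ∑[ i < n ] (A i i * (x i * x i))
quad-diag A x = trans (quad-diagonal (diag A) off x) (sum-cong-≋ λ i → *-congʳ (on i))
  where
  off : ∀ i j → j ≢ i → diag A i j ≈ 0ℝ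
  off i j j≢i with i Fin.≟ j
  ... | yes i≡j = contradiction (≡.sym i≡j) j≢i
  ... | no _    = refl
  on : ∀ i → diag A i i ≈ A i i
  on i with i Fin.≟ i
  ... | yes _  = refl
  ... | no i≢i = contradiction ≡.refl i≢i

-- The squared Euclidean norm as a diagonal form with unit entries, so that the `normalised` field
-- of a Euclidean frame speaks of `norm²` as it stands.
norm² : ∀ {n} → Vector ℝ n → ℝ
norm² x = diagForm (λ _ → 1ℝ) ⟪ x , x ⟫

norm²-∑ : ∀ {n} (x : Vector ℝ n) → norm² x ≈ ∑[ i < n ] (x i * x i)
norm²-∑ x = sum-cong-≋ λ i → *-congʳ (*-identityˡ (x i))

quad-I : ∀ {n} (x : Vector ℝ n) → quad I x ≈ norm² x
quad-I x = trans (quad-diagonal I (λ i j j≢i → e-off (λ eq → j≢i (≡.sym eq))) x)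
  (sum-cong-≋ λ i → trans (*-congʳ (e-diag i)) (sym (*-assoc 1ℝ (x i) (x i))))

-- The estimate for a feasible solution at a fixed perturbation.

module _ {n ℓ : ℕ} (β : ℝ) (β>0 : 0ℝ < β) (w : Vector (Vector ℝ n) ℓ)
         {η : Vector ℝ ℓ} {q : Vector ℝ n} {G : Matrix n}
         (feasible : SDP.Feasible β β>0 w η q G) where

  open SDP β β>0 w
  open Feasible feasible

  -- The perturbation β s keeps the diagonal of G invertible; it costs s per dimension.
  module _ (s : ℝ) (0<s : 0ℝ < s) where
    private
      r : ℝ
      r = recip β β>0

      d : Vector ℝ n
      d i = G i i + β * s

      0≤Gᵢᵢ : ∀ i → 0ℝ ≤ G i i
      0≤Gᵢᵢ i = ≤-trans (PSD.nonnegative G-psd (e i)) (≤-reflexive (quad-e G i))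

      0<d : ∀ i → 0ℝ < d i
      0<d i = <-respʳ-≈ (+-comm (β * s) (G i i)) (0<⇒+ˡ (*-pos β>0 0<s) (0≤Gᵢᵢ i))

      ρ : Vector ℝ n
      ρ i = recip (d i) (0<d i)

      dρ≈1 : ∀ i → d i * ρ i ≈ 1ℝ
      dρ≈1 i = *-recip (d i) (0<d i)

      D Γ Q : SymForm n
      D = diagForm d
      Γ = matForm G (PSD.symmetric G-psd)
      Q = record
        { op         = λ u i → r * op D u i + (- 1ℝ) * op Γ u i
        ; op-selfadj = λ u v → trans (dot-linearˡ r (- 1ℝ) (op D u) (op Γ u) v)
            (trans (+-cong (*-congˡ (op-selfadj D u v)) (*-congˡ (op-selfadj Γ u v)))
                   (sym (dot-linearˡ r (- 1ℝ) (op D v) (op Γ v) u)))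
        }

      Q-def : ∀ x → Q ⟪ x , x ⟫ ≈ r * D ⟪ x , x ⟫ - quad G x
      Q-def x = begin
        Q ⟪ x , x ⟫                                   ≈⟨ dot-linearˡ r (- 1ℝ) (op D x) (op Γ x) x ⟩
        r * D ⟪ x , x ⟫ + (- 1ℝ) * Γ ⟪ x , x ⟫        ≈⟨ +-congˡ (*-congˡ (dot-apply G x x)) ⟩
        r * D ⟪ x , x ⟫ + (- 1ℝ) * quad G x
          ≈⟨ solve 2 (λ a b → a :+ (:- con 1ℚ) :* b := a :- b) refl (r * D ⟪ x , x ⟫) (quad G x) ⟩
        r * D ⟪ x , x ⟫ - quad G x                    ∎
        where open ≈-Reasoning

      D-split : ∀ x → D ⟪ x , x ⟫ ≈ quad (diag G) x + (β * s) * norm² x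
      D-split x = begin
        D ⟪ x , x ⟫
          ≈⟨ sum-cong-≋ (λ i → solve 3 (λ g t x → (g :+ t) :* x :* x := g :* (x :* x) :+ t :* (x :* x)) refl (G i i) (β * s) (x i)) ⟩
        ∑[ i < n ] (G i i * (x i * x i) + (β * s) * (x i * x i))
          ≈⟨ ∑-distrib-+ (λ i → G i i * (x i * x i)) (λ i → (β * s) * (x i * x i)) ⟩
        ∑[ i < n ] (G i i * (x i * x i)) + ∑[ i < n ] ((β * s) * (x i * x i))
          ≈⟨ +-cong (sym (quad-diag G x)) (trans (sym (*-distribˡ-sum (β * s) (λ i → x i * x i))) (*-congˡ (sym (norm²-∑ x)))) ⟩
        quad (diag G) x + (β * s) * norm² x ∎
        where open ≈-Reasoning

      -- Each ratio of `G i i` to `d i` is at most 1, because the perturbation only enlarges the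
      -- denominator.
      trace≤n : ∑[ i < n ] (G i i * ρ i) ≤ fromℕ n
      trace≤n = begin
        ∑[ i < n ] (G i i * ρ i)   ≲⟨ sum-mono-≤ (λ i → begin
            G i i * ρ i              ≈⟨ +-identityʳ _ ⟨
            G i i * ρ i + 0ℝ
              ≲⟨ +-mono-≤ ≤-refl (0≤⇒* (<⇒≤ (*-pos β>0 0<s)) (0≤-inverse (<⇒≤ (0<d i)) (dρ≈1 i))) ⟩
            G i i * ρ i + β * s * ρ i
              ≈⟨ solve 3 (λ g t p → g :* p :+ t :* p := (g :+ t) :* p) refl (G i i) (β * s) (ρ i) ⟩
            d i * ρ i                ≈⟨ dρ≈1 i ⟩
            1ℝ                       ∎) ⟩
        ∑[ i < n ] 1ℝ              ≈⟨ sum-const n 1ℝ ⟩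
        fromℕ n * 1ℝ               ≈⟨ *-identityʳ (fromℕ n) ⟩
        fromℕ n                    ∎
        where open ≤-Reasoning

      βr≈1 : β * r ≈ 1ℝ
      βr≈1 = *-recip β β>0

      p≤βn : ∀ {p} → NegativeFamily Q p → fromℕ p ≤ β * fromℕ n
      p≤βn {p} y = begin
        fromℕ p              ≈⟨ *-identityʳ (fromℕ p) ⟨
        fromℕ p * 1ℝ         ≈⟨ *-congˡ βr≈1 ⟨
        fromℕ p * (β * r)    ≈⟨ solve 3 (λ p b r → p :* (b :* r) := b :* (p :* r)) refl (fromℕ p) β r ⟩
        β * (fromℕ p * r)    ≲⟨ *-monoˡ-≤ (<⇒≤ β>0) (≤-trans (negative-count 0<d dρ≈1 G-psd Q-def y) trace≤n) ⟩
        β * fromℕ n          ∎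
        where open ≤-Reasoning

      W : Matrix n
      W = ∑ᴹ (λ k → η k · outer (w k))

      diagq : Matrix n
      diagq = ∑ᴹ (λ i → q i · outer (e i))

      0≤objective : 0ℝ ≤ objective q
      0≤objective = 0≤sum q≥0

      module _ (u : Vector ℝ n) (w⊥u : ∀ k → dot (w k) u ≈ 0ℝ) (0≤Qu : 0ℝ ≤ Q ⟪ u , u ⟫) where

        W-vanishes : quad W u ≈ 0ℝ
        W-vanishes = trans (quad-∑ᴹ (λ k → η k · outer (w k)) u) (sum-zero λ k →
          trans (quad-· (η k) (outer (w k)) u)
            (trans (*-congˡ (trans (quad-outer (w k) u) (trans (*-congʳ (w⊥u k)) (zeroˡ _)))) (zeroʳ (η k))))

        quad-constraint : quad (W ⊕ G ⊖ r · diag G ⊕ diagq ⊖ I) u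
                        ≈ quad W u + quad G u - r * quad (diag G) u + quad diagq u - norm² u
        quad-constraint = trans (quad-⊖ (W ⊕ G ⊖ r · diag G ⊕ diagq) I u)
          (+-cong (trans (quad-⊕ (W ⊕ G ⊖ r · diag G) diagq u)
            (+-congʳ (trans (quad-⊖ (W ⊕ G) (r · diag G) u)
              (+-cong (quad-⊕ W G u) (-‿cong (quad-· r (diag G) u))))))
            (-‿cong (quad-I u)))

        -- In the sum of the constraint and Q at `u`, the terms in `G` and in its diagonal cancel.
        -- What is left of D/β is (β s)/β = s times the squared norm.
        norm≤diagq : norm² u - s * norm² u ≤ quad diagq u
        norm≤diagq = 0≤y-x⇒x≤y (begin
          0ℝ
            ≲⟨ 0≤⇒+ (PSD.nonnegative constraint u) 0≤Qu ⟩
          quad (W ⊕ G ⊖ r · diag G ⊕ diagq ⊖ I) u + Q ⟪ u , u ⟫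
            ≈⟨ +-cong quad-constraint (trans (Q-def u) (+-congʳ (*-congˡ (D-split u)))) ⟩
          (quad W u + g - r * h + t - N) + (r * (h + (β * s) * N) - g)
            ≈⟨ +-congʳ (+-congʳ (+-congʳ (+-congʳ (+-congʳ W-vanishes)))) ⟩
          (0ℝ + g - r * h + t - N) + (r * (h + (β * s) * N) - g)
            ≈⟨ solve 7 (λ g h t N r b s → (con 0ℚ :+ g :- r :* h :+ t :- N) :+ (r :* (h :+ (b :* s) :* N) :- g)
                                        := t :- (N :- (b :* r) :* (s :* N))) refl g h t N r β s ⟩
          t - (N - (β * r) * (s * N))
            ≈⟨ +-congˡ (-‿cong (+-congˡ (-‿cong (trans (*-congʳ βr≈1) (*-identityˡ (s * N)))))) ⟩
          t - (N - s * N) ∎)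
          where
          open ≤-Reasoning
          g = quad G u
          h = quad (diag G) u
          t = quad diagq u
          N = norm² u

      -- Each direction of an orthonormal frame cut out by the ℓ + p equations contributes at least
      -- `1ℝ - s` to the trace of diag(q), and that trace is the objective.
      dimension-bound : ∀ {p} (y : NegativeFamily Q p) → Maximal y → ∀ m → (ℓ ℕ.+ p) ℕ.+ m ℕ.≤ n →
                        fromℕ m * (1ℝ - s) ≤ objective q
      dimension-bound {p} y maximal m ≤n = ≤-stable
        (frame-of-size (diagForm-posDef {d = λ _ → 1ℝ} (λ _ → 0<1)) m ≤n >>= λ φ → pure (bound φ))
        where
        open ≤-Reasoning
        F : Vector (Vector ℝ n) (ℓ ℕ.+ p)
        F = w ++ λ k → op Q (vector y k)
        bound : Frame (diagForm (λ _ → 1ℝ)) F m → fromℕ m * (1ℝ - s) ≤ objective q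
        bound φ = begin
          fromℕ m * (1ℝ - s)                       ≈⟨ sum-const m (1ℝ - s) ⟨
          ∑[ k < m ] (1ℝ - s)                      ≲⟨ sum-mono-≤ 1-s≤ ⟩
          ∑[ k < m ] (c k * quad diagq (u k))      ≲⟨ trace-bound (λ _ → 0<1) (λ _ → *-identityˡ 1ℝ) (n ℕ.∸ m)
                                                        (ℕ.m∸n+n≡m (frame-size φ)) ψ (diagonal-psd q≥0) ⟩
          ∑[ i < n ] (diagq i i * 1ℝ)
            ≈⟨ sum-cong-≋ (λ i → trans (*-identityʳ _) (diagonal-entry q i)) ⟩
          objective q                              ∎
          where
          u = vec φ
          c = weight φ
          -- Completing the frame to a basis of the whole space leaves the subspace cut out by `F`,
          -- so those equations are dropped first.
          ψ : Frame (diagForm (λ _ → 1ℝ)) [] m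
          ψ = record { vec = u ; weight = c ; weight≥0 = weight≥0 φ ; orthogonal = orthogonal φ
                     ; normalised = normalised φ ; killed = λ () }
          w⊥u : ∀ k f → dot (w f) (u k) ≈ 0ℝ
          w⊥u k f = subst (λ v → dot v (u k) ≈ 0ℝ) (Vector.lookup-++ˡ w (λ k → op Q (vector y k)) f) (killed φ (f ↑ˡ p) k)
          0≤Qu : ∀ k → 0ℝ ≤ Q ⟪ u k , u k ⟫
          0≤Qu k = maximal (u k) λ f →
            subst (λ v → dot v (u k) ≈ 0ℝ) (Vector.lookup-++ʳ w (λ k → op Q (vector y k)) f) (killed φ (ℓ ↑ʳ f) k)
          1-s≤ : ∀ k → 1ℝ - s ≤ c k * quad diagq (u k)
          1-s≤ k = begin
            1ℝ - s
              ≈⟨ +-cong (normalised φ k) (-‿cong (trans (*-congˡ (normalised φ k)) (*-identityʳ s))) ⟨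
            c k * norm² (u k) - s * (c k * norm² (u k))
              ≈⟨ solve 3 (λ c N s → c :* N :- s :* (c :* N) := c :* (N :- s :* N)) refl (c k) (norm² (u k)) s ⟩
            c k * (norm² (u k) - s * norm² (u k))
              ≲⟨ *-monoˡ-≤ (weight≥0 φ k) (norm≤diagq (u k) (w⊥u k) (0≤Qu k)) ⟩
            c k * quad diagq (u k)                     ∎

    -- Free of subtraction, so that it also covers n ≤ ℓ + p: there no subspace is left, and the
    -- bound on ℓ + p is enough.
    perturbed-bound : fromℕ n ≤ fromℕ ℓ + β * fromℕ n + (objective q + fromℕ n * s)
    perturbed-bound = ≤-stable
      (maximal-family {Q = Q} n (ℕ.+-identityʳ n) record { vector = [] ; orthogonal = λ () ; negative = λ () } >>= λ where
        (p , y , inj₁ p≡n)     → pure (few p y (ℕ.≤-trans (ℕ.≤-reflexive (≡.sym p≡n)) (ℕ.m≤n+m p ℓ)))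
        (p , y , inj₂ maximal) → pure (go p y maximal (ℕ.≤-total n (ℓ ℕ.+ p))))
      where
      open ≤-Reasoning
      0≤rest : 0ℝ ≤ objective q + fromℕ n * s
      0≤rest = 0≤⇒+ 0≤objective (0≤⇒* (0≤fromℕ n) (<⇒≤ 0<s))
      ℓ+p≤ : ∀ p → NegativeFamily Q p → fromℕ (ℓ ℕ.+ p) ≤ fromℕ ℓ + β * fromℕ n
      ℓ+p≤ p y = ≤-trans (≤-reflexive (fromℕ-+ ℓ p)) (+-mono-≤ ≤-refl (p≤βn y))
      few : ∀ p → NegativeFamily Q p → n ℕ.≤ ℓ ℕ.+ p → _
      few p y n≤ℓ+p = begin
        fromℕ n                                                    ≲⟨ fromℕ-mono-≤ n≤ℓ+p ⟩
        fromℕ (ℓ ℕ.+ p)                                            ≈⟨ +-identityʳ _ ⟨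
        fromℕ (ℓ ℕ.+ p) + 0ℝ                                       ≲⟨ +-mono-≤ (ℓ+p≤ p y) 0≤rest ⟩
        fromℕ ℓ + β * fromℕ n + (objective q + fromℕ n * s)        ∎
      go : ∀ p (y : NegativeFamily Q p) → Maximal y → n ℕ.≤ ℓ ℕ.+ p ⊎ ℓ ℕ.+ p ℕ.≤ n → _
      go p y maximal (inj₁ n≤ℓ+p) = few p y n≤ℓ+p
      go p y maximal (inj₂ ℓ+p≤n) = begin
        fromℕ n                             ≈⟨ reflexive (cong fromℕ ℓ+p+m≡n) ⟨
        fromℕ (ℓ ℕ.+ p ℕ.+ m)               ≈⟨ fromℕ-+ (ℓ ℕ.+ p) m ⟩
        fromℕ (ℓ ℕ.+ p) + fromℕ m           ≲⟨ +-mono-≤ (ℓ+p≤ p y) m≤ ⟩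
        fromℕ ℓ + β * fromℕ n + (objective q + fromℕ n * s) ∎
        where
        m = n ℕ.∸ (ℓ ℕ.+ p)
        ℓ+p+m≡n = ℕ.m+[n∸m]≡n ℓ+p≤n
        m≤ : fromℕ m ≤ objective q + fromℕ n * s
        m≤ = begin
          fromℕ m
            ≈⟨ solve 2 (λ m s → m := m :* (con 1ℚ :- s) :+ s :* m) refl (fromℕ m) s ⟩
          -- The family, and `m` with it, varies with `s`; replacing s m by s n gives an error whose
          -- factor is fixed as `s` tends to 0.
          fromℕ m * (1ℝ - s) + s * fromℕ m     ≲⟨ +-mono-≤ (dimension-bound y maximal m (ℕ.≤-reflexive ℓ+p+m≡n))
                                                    (*-monoˡ-≤ (<⇒≤ 0<s) (fromℕ-mono-≤ (ℕ.m∸n≤m n (ℓ ℕ.+ p)))) ⟩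
          objective q + s * fromℕ n            ≈⟨ +-congˡ (*-comm s (fromℕ n)) ⟩
          objective q + fromℕ n * s            ∎

-- Removing the perturbation.

≤-archimedean : ∀ n {x y} → (∀ s → 0ℝ < s → x ≤ y + fromℕ n * s) → x ≤ y
≤-archimedean n {x} {y} x≤y+ns = ≮⇒≥ λ y<x → <⇒≱ (x<y⇒0<y-x y<x) (begin
  x - y                  ≈⟨ z≈s+ns ⟩
  s + fromℕ n * s        ≲⟨ +-mono-≤ s≤0 (*-monoˡ-≤ (0≤fromℕ n) s≤0) ⟩
  0ℝ + fromℕ n * 0ℝ      ≈⟨ solve 1 (λ k → con 0ℚ :+ k :* con 0ℚ := con 0ℚ) refl (fromℕ n) ⟩
  0ℝ                     ∎)
  where
  open ≤-Reasoning
  0<1+n : 0ℝ < fromℕ (suc n)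
  0<1+n = <-respʳ-≈ (sym (fromℕ-suc n)) (0<⇒+ˡ 0<1 (0≤fromℕ n))
  -- The test value (x - y)/(n + 1). Then x - y exceeds n s by exactly one `s`, which the hypothesis
  -- forbids for positive `s`; the divisor n + 1 is positive even for n = 0.
  s = recip (fromℕ (suc n)) 0<1+n * (x - y)
  z≈s+ns : x - y ≈ s + fromℕ n * s
  z≈s+ns = begin-equality
    x - y                                                ≈⟨ *-identityˡ (x - y) ⟨
    1ℝ * (x - y)                                         ≈⟨ *-congʳ (*-recip (fromℕ (suc n)) 0<1+n) ⟨
    fromℕ (suc n) * recip (fromℕ (suc n)) 0<1+n * (x - y) ≈⟨ *-assoc _ _ _ ⟩
    fromℕ (suc n) * s                                    ≈⟨ *-congʳ (fromℕ-suc n) ⟩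
    (1ℝ + fromℕ n) * s
      ≈⟨ solve 2 (λ k s → (con 1ℚ :+ k) :* s := s :+ k :* s) refl (fromℕ n) s ⟩
    s + fromℕ n * s                                      ∎
  s≤0 : s ≤ 0ℝ
  s≤0 = ≮⇒≥ λ 0<s → <⇒≱ 0<s (begin
    s                                ≈⟨ solve 2 (λ s k → s := (s :+ k) :- k) refl s (fromℕ n * s) ⟩
    s + fromℕ n * s - fromℕ n * s    ≈⟨ +-congʳ z≈s+ns ⟨
    x - y - fromℕ n * s              ≲⟨ +-mono-≤ (+-mono-≤ (x≤y+ns s 0<s) ≤-refl) ≤-refl ⟩
    y + fromℕ n * s - y - fromℕ n * s ≈⟨ solve 2 (λ y k → y :+ k :- y :- k := con 0ℚ) refl y (fromℕ n * s) ⟩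
    0ℝ                               ∎)

theorem14 : ∀ (n ℓ : ℕ) (δ β : ℝ) →
    0ℝ ≤ δ → δ < 1ℝ →
    (β>0 : 0ℝ < β) → β < 1ℝ - δ →
    fromℕ ℓ ≈ δ * fromℕ n →
    (w : Vector (Vector ℝ n) ℓ) →
    let open SDP β β>0 w in
    (∀ η q G → Feasible η q G → (1ℝ - δ - β) * fromℕ n ≤ objective q)
    × (∀ opt → IsInfimum IsObjectiveValue opt → (1ℝ - δ - β) * fromℕ n ≤ opt)
theorem14 n ℓ δ β _ _ β>0 _ ℓ≈δn w = bound , λ opt (_ , greatest) →
  -- The first part makes the number a lower bound of all objective values, and the infimum
  -- dominates every such bound.
  greatest _ λ v (η , q , G , feasible , v≈) → ≤-trans (bound η q G feasible) (≤-reflexive (sym v≈))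
  where
  open SDP β β>0 w
  open ≤-Reasoning
  bound : ∀ η q G → Feasible η q G → (1ℝ - δ - β) * fromℕ n ≤ objective q
  bound η q G feasible = ≤-archimedean n λ s 0<s → begin
    (1ℝ - δ - β) * fromℕ n
      ≈⟨ solve 3 (λ d b k → (con 1ℚ :- d :- b) :* k := k :- d :* k :- b :* k) refl δ β (fromℕ n) ⟩
    fromℕ n - δ * fromℕ n - β * fromℕ n
      ≈⟨ +-congʳ (+-congˡ (-‿cong ℓ≈δn)) ⟨
    fromℕ n - fromℕ ℓ - β * fromℕ n
      ≲⟨ +-mono-≤ (+-mono-≤ (perturbed-bound β β>0 w feasible s 0<s) ≤-refl) ≤-refl ⟩
    fromℕ ℓ + β * fromℕ n + (objective q + fromℕ n * s) - fromℕ ℓ - β * fromℕ n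
      ≈⟨ solve 3 (λ l b t → l :+ b :+ t :- l :- b := t) refl (fromℕ ℓ) (β * fromℕ n) (objective q + fromℕ n * s) ⟩
    objective q + fromℕ n * s ∎
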